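{- Let $n$ be a positive integer, let $p\ge q$ be positive integers, and let $B$ be a $p\times q$ matrix with nonnegative real entries. For each positive divisor $k$ of $n$, let $F_k$ be the symmetric block matrix of size $kq+\frac{n}{k}p$ whose block rows and columns have sizes, in order, $p$, then $q$ repeated $k$ times, then $p$ repeated $\frac{n}{k}-1$ times; the block in a size-$p$ block row and a size-$q$ block column is $B$, the block in a size-$q$ block row and a size-$p$ block column is $B^T$, and all other blocks are zero. Then the normalized Laplacians $L\big(F_k\oplus 0_{(n-\frac{n}{k})p+(1-k)q}\big)$, as $k$ ranges over all positive divisors of $n$, are pairwise cospectral.
   Context: For matrices $X,Y$, $X\oplus Y=\begin{bmatrix} X&0\\0&Y\end{bmatrix}$; $0_m$ is the $m\times m$ zero matrix. For a nonnegative real symmetric matrix $M$ with positive row sums, its normalized Laplacian is $L(M)=I-\Delta^{ -1/2}M\Delta^{ -1/2}$, where $\Delta$ is the diagonal matrix of row sums of $M$. If $M$ has zero row sums, write (after a simultaneous permutation of rows and columns) $M=M_1\oplus 0_k$ where $M_1$ has positive row sums; then $L(M)=L(M_1)\oplus I_k$. Two square matrices are cospectral if they have the same eigenvalues with the same multiplicities. -}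

module Defs where

open import Algebra.Apartness.Bundles using (HeytingField; HeytingCommutativeRing)
open import Algebra.Bundles using (CommutativeRing; AbelianGroup)
import Algebra.Construct.DirectProduct as DirectProduct
import Algebra.Properties.CommutativeMonoid.Sum as Sum
import Algebra.Properties.Monoid.Mult as Mult
import Algebra.Properties.Ring as RingProperties
import Algebra.Properties.Semiring.Exp as Exp
import Algebra.Solver.Ring.NaturalCoefficients.Default as RingSolver
open import Data.Fin.Base using (Fin; zero; suc; toℕ; punchIn; splitAt; remainder)
open import Data.Fin.Permutation using (Permutation; _⟨$⟩ʳ_)
import Data.Fin.Properties as Fin
open import Data.List.Base using (List; foldr)
open import Data.Nat.Base as ℕ using (ℕ; zero; suc; NonZero)
open import Data.Nat.DivMod using (_/_; m*n/n≡m)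
open import Data.Nat.Divisibility using (_∣_; divides)
import Data.Nat.Properties as ℕ
import Data.Nat.Tactic.RingSolver as ℕ-Solver
open import Data.Product.Base using (_×_; _,_; ∃; ∃-syntax; Σ-syntax)
open import Data.Sum.Base using (_⊎_; inj₁; inj₂; [_,_]′)
open import Data.Vec.Functional using (Vector)
open import Function.Base using (_∘_)
open import Function.Bundles using (_⇔_)
open import Level using (Level; _⊔_) renaming (suc to lsuc)
open import Relation.Binary.Core using (Rel)
open import Relation.Binary.PropositionalEquality as ≡ using (_≡_; refl; cong; module ≡-Reasoning)
import Relation.Binary.Reasoning.Setoid as SetoidReasoning
open import Relation.Binary.Structures using (IsStrictPartialOrder)
open import Relation.Nullary.Decidable.Core using (yes; no)
open import Relation.Nullary.Negation.Core using (¬_)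

-- The real numbers, axiomatised as an Archimedean, Cauchy-complete ordered
-- field.  Classically this determines ℝ up to unique isomorphism; the axioms
-- are phrased so that Bishop's constructive reals satisfy them as well.
record RealField c ℓ₁ ℓ₂ : Set (lsuc (c ⊔ ℓ₁ ⊔ ℓ₂)) where
  field
    heytingField : HeytingField c ℓ₁ ℓ₂

  open HeytingField heytingField public
  open HeytingCommutativeRing heytingCommutativeRing public using (commutativeRing)
  open Mult (CommutativeRing.+-monoid commutativeRing) public using () renaming (_×_ to _×ℕ_)

  infix 4 _<_ _≤_

  field
    _<_                  : Rel Carrier ℓ₂
    isStrictPartialOrder : IsStrictPartialOrder _≈_ _<_
    #⇒<⊎>                : ∀ {x y} → x # y → x < y ⊎ y < x
    <⇒#                  : ∀ {x y} → x < y → x # y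
    +-monoˡ-<            : ∀ {x y} z → x < y → x + z < y + z
    *-pos                : ∀ {x y} → 0# < x → 0# < y → 0# < x * y
    archimedean          : ∀ x → ∃[ n ] x < n ×ℕ 1#

  _≤_ : Rel Carrier ℓ₂
  x ≤ y = ¬ (y < x)

  Cauchy : (ℕ → Carrier) → Set (c ⊔ ℓ₂)
  Cauchy s = ∀ ε → 0# < ε → ∃[ N ] (∀ m n → N ℕ.≤ m → N ℕ.≤ n → s m - s n < ε)

  _ConvergesTo_ : (ℕ → Carrier) → Carrier → Set (c ⊔ ℓ₂)
  s ConvergesTo x = ∀ ε → 0# < ε → ∃[ N ] (∀ n → N ℕ.≤ n → s n - x < ε × x - s n < ε)

  field
    complete : ∀ s → Cauchy s → ∃ (s ConvergesTo_)

module _ {c ℓ} (R : CommutativeRing c ℓ) where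

  private
    module R = CommutativeRing R

    open RingSolver R.commutativeSemiring using (solve; _:=_; _:+_; _:*_; con)

    pairs : AbelianGroup c ℓ
    pairs = DirectProduct.abelianGroup R.+-abelianGroup R.+-abelianGroup

    open AbelianGroup pairs using (Carrier; _≈_; _∙_; _⁻¹; ε; setoid; trans; sym; ∙-cong; isAbelianGroup)

    _*ᶜ_ : Carrier → Carrier → Carrier
    (a , b) *ᶜ (c , d) = (a R.* c R.- b R.* d) , (a R.* d R.+ b R.* c)

    -- Multiplication in R[√m]; its laws are polynomial identities without
    -- subtraction, and those of _*ᶜ_ are the case m = -1.
    mul : R.Carrier → Carrier → Carrier → Carrier
    mul m (a , b) (c , d) = (a R.* c R.+ m R.* (b R.* d)) , (a R.* d R.+ b R.* c)

    mul-assoc-re : ∀ m a b c d e f →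
      (a R.* c R.+ m R.* (b R.* d)) R.* e R.+ m R.* ((a R.* d R.+ b R.* c) R.* f)
        R.≈ a R.* (c R.* e R.+ m R.* (d R.* f)) R.+ m R.* (b R.* (c R.* f R.+ d R.* e))
    mul-assoc-re = solve 7 (λ m a b c d e f → (a :* c :+ m :* (b :* d)) :* e :+ m :* ((a :* d :+ b :* c) :* f) := a :* (c :* e :+ m :* (d :* f)) :+ m :* (b :* (c :* f :+ d :* e))) R.refl

    mul-assoc-im : ∀ m a b c d e f →
      (a R.* c R.+ m R.* (b R.* d)) R.* f R.+ (a R.* d R.+ b R.* c) R.* e
        R.≈ a R.* (c R.* f R.+ d R.* e) R.+ b R.* (c R.* e R.+ m R.* (d R.* f))
    mul-assoc-im = solve 7 (λ m a b c d e f → (a :* c :+ m :* (b :* d)) :* f :+ (a :* d :+ b :* c) :* e := a :* (c :* f :+ d :* e) :+ b :* (c :* e :+ m :* (d :* f))) R.refl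

    mul-comm-re : ∀ m a b c d → a R.* c R.+ m R.* (b R.* d) R.≈ c R.* a R.+ m R.* (d R.* b)
    mul-comm-re = solve 5 (λ m a b c d → a :* c :+ m :* (b :* d) := c :* a :+ m :* (d :* b)) R.refl

    mul-comm-im : ∀ a b c d → a R.* d R.+ b R.* c R.≈ c R.* b R.+ d R.* a
    mul-comm-im = solve 4 (λ a b c d → a :* d :+ b :* c := c :* b :+ d :* a) R.refl

    mul-identity-re : ∀ m a b → R.1# R.* a R.+ m R.* (R.0# R.* b) R.≈ a
    mul-identity-re = solve 3 (λ m a b → con 1 :* a :+ m :* (con 0 :* b) := a) R.refl

    mul-identity-im : ∀ a b → R.1# R.* b R.+ R.0# R.* a R.≈ b
    mul-identity-im = solve 2 (λ a b → con 1 :* b :+ con 0 :* a := b) R.refl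

    mul-distribʳ-re : ∀ m a b c d e f →
      (c R.+ e) R.* a R.+ m R.* ((d R.+ f) R.* b)
        R.≈ (c R.* a R.+ m R.* (d R.* b)) R.+ (e R.* a R.+ m R.* (f R.* b))
    mul-distribʳ-re = solve 7 (λ m a b c d e f → (c :+ e) :* a :+ m :* ((d :+ f) :* b) := (c :* a :+ m :* (d :* b)) :+ (e :* a :+ m :* (f :* b))) R.refl

    mul-distribʳ-im : ∀ a b c d e f →
      (c R.+ e) R.* b R.+ (d R.+ f) R.* a
        R.≈ (c R.* b R.+ d R.* a) R.+ (e R.* b R.+ f R.* a)
    mul-distribʳ-im = solve 6 (λ a b c d e f → (c :+ e) :* b :+ (d :+ f) :* a := (c :* b :+ d :* a) :+ (e :* b :+ f :* a)) R.refl

    mul-cong : ∀ m {x y u v} → x ≈ y → u ≈ v → mul m x u ≈ mul m y v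
    mul-cong m (a , b) (c , d) =
      R.+-cong (R.*-cong a c) (R.*-cong R.refl (R.*-cong b d)) ,
      R.+-cong (R.*-cong a d) (R.*-cong b c)

    -1ᴿ : R.Carrier
    -1ᴿ = R.- R.1#

    *ᶜ≈mul : ∀ x y → x *ᶜ y ≈ mul -1ᴿ x y
    *ᶜ≈mul (a , b) (c , d) = R.+-cong R.refl (R.sym (-1*x≈-x (b R.* d))) , R.refl
      where open RingProperties R.ring using (-1*x≈-x)

    *ᶜ-cong : ∀ {x y u v} → x ≈ y → u ≈ v → x *ᶜ u ≈ y *ᶜ v
    *ᶜ-cong p q = trans (*ᶜ≈mul _ _) (trans (mul-cong -1ᴿ p q) (sym (*ᶜ≈mul _ _)))

    *ᶜ-assoc : ∀ x y z → (x *ᶜ y) *ᶜ z ≈ x *ᶜ (y *ᶜ z)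
    *ᶜ-assoc x@(a , b) y@(c , d) z@(e , f) = begin
      (x *ᶜ y) *ᶜ z               ≈⟨ *ᶜ-cong (*ᶜ≈mul x y) (R.refl , R.refl) ⟩
      mul -1ᴿ x y *ᶜ z            ≈⟨ *ᶜ≈mul _ z ⟩
      mul -1ᴿ (mul -1ᴿ x y) z     ≈⟨ mul-assoc-re -1ᴿ a b c d e f , mul-assoc-im -1ᴿ a b c d e f ⟩
      mul -1ᴿ x (mul -1ᴿ y z)     ≈⟨ *ᶜ≈mul x _ ⟨
      x *ᶜ mul -1ᴿ y z            ≈⟨ *ᶜ-cong (R.refl , R.refl) (*ᶜ≈mul y z) ⟨
      x *ᶜ (y *ᶜ z)               ∎
      where open SetoidReasoning setoid

    *ᶜ-comm : ∀ x y → x *ᶜ y ≈ y *ᶜ x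
    *ᶜ-comm x@(a , b) y@(c , d) =
      trans (*ᶜ≈mul x y) (trans (mul-comm-re -1ᴿ a b c d , mul-comm-im a b c d) (sym (*ᶜ≈mul y x)))

    *ᶜ-identityˡ : ∀ x → (R.1# , R.0#) *ᶜ x ≈ x
    *ᶜ-identityˡ x@(a , b) = trans (*ᶜ≈mul _ x) (mul-identity-re -1ᴿ a b , mul-identity-im a b)

    *ᶜ-distribʳ : ∀ x y z → (y ∙ z) *ᶜ x ≈ (y *ᶜ x) ∙ (z *ᶜ x)
    *ᶜ-distribʳ x@(a , b) y@(c , d) z@(e , f) =
      trans (*ᶜ≈mul _ x)
        (trans (mul-distribʳ-re -1ᴿ a b c d e f , mul-distribʳ-im a b c d e f)
          (sym (∙-cong (*ᶜ≈mul y x) (*ᶜ≈mul z x))))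

  -- R[i]/(i² + 1): the pair (a , b) stands for a + bi.
  complexRing : CommutativeRing c ℓ
  complexRing = record
    { Carrier = Carrier
    ; _≈_ = _≈_
    ; _+_ = _∙_
    ; _*_ = _*ᶜ_
    ; -_ = _⁻¹
    ; 0# = ε
    ; 1# = R.1# , R.0#
    ; isCommutativeRing = record
      { isRing = record
        { +-isAbelianGroup = isAbelianGroup
        ; *-cong = *ᶜ-cong
        ; *-assoc = *ᶜ-assoc
        ; *-identity = *ᶜ-identityˡ , λ x → trans (*ᶜ-comm x _) (*ᶜ-identityˡ x)
        ; distrib = (λ x y z → trans (*ᶜ-comm x _)
                                 (trans (*ᶜ-distribʳ x y z) (∙-cong (*ᶜ-comm y x) (*ᶜ-comm z x))))
                  , *ᶜ-distribʳ
        }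
      ; *-comm = *ᶜ-comm
      }
    }

module Matrices {c ℓ} (R : CommutativeRing c ℓ) where

  open CommutativeRing R using (Carrier; _≈_; _+_; _*_; _-_; -_; 0#; 1#; semiring; +-commutativeMonoid)
  open Exp semiring public using (_^_)
  open Sum +-commutativeMonoid public using (sum)

  Matrix : ℕ → ℕ → Set c
  Matrix m n = Fin m → Fin n → Carrier

  infix 4 _≈ₘ_
  _≈ₘ_ : ∀ {m n} → Matrix m n → Matrix m n → Set ℓ
  X ≈ₘ Y = ∀ i j → X i j ≈ Y i j

  0ₘ : ∀ n → Matrix n n
  0ₘ n i j = 0#

  Iₘ : ∀ n → Matrix n n
  Iₘ n i j with i Fin.≟ j
  ... | yes _ = 1#
  ... | no  _ = 0#

  infixr 5 _⊕_
  _⊕_ : ∀ {m n} → Matrix m m → Matrix n n → Matrix (m ℕ.+ n) (m ℕ.+ n)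
  _⊕_ {m} X Y i j with splitAt m i | splitAt m j
  ... | inj₁ i′ | inj₁ j′ = X i′ j′
  ... | inj₁ _  | inj₂ _  = 0#
  ... | inj₂ _  | inj₁ _  = 0#
  ... | inj₂ i′ | inj₂ j′ = Y i′ j′

  rowSum : ∀ {m n} → Matrix m n → Fin m → Carrier
  rowSum M i = sum (M i)

  infixr 7 _·ᵥ_
  _·ᵥ_ : ∀ {m n} → Matrix m n → Vector Carrier n → Vector Carrier m
  (M ·ᵥ v) i = sum (λ j → M i j * v j)

  -- Laplace expansion along the first row.
  det : ∀ {n} → Matrix n n → Carrier
  det {zero}  M = 1#
  det {suc n} M = sum (λ j → (- 1#) ^ toℕ j * M zero j * det (λ i k → M (suc i) (punchIn j k)))

  charPoly : ∀ {n} → Matrix n n → Carrier → Carrier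
  charPoly {n} M x = det (λ i j → x * Iₘ n i j - M i j)

  -- Coefficients are listed from the constant term upwards.
  evalPoly : List Carrier → Carrier → Carrier
  evalPoly g x = foldr (λ a r → a + x * r) 0# g

  IsEigenvalue : ∀ {n} → Matrix n n → Carrier → Set (c ⊔ ℓ)
  IsEigenvalue {n} M λ′ = Σ[ v ∈ Vector Carrier n ] ¬ (∀ i → v i ≈ 0#) × (∀ i → (M ·ᵥ v) i ≈ λ′ * v i)

  -- λ′ is a root of order m of the characteristic polynomial, i.e. the latter
  -- is (x - λ′)ᵐ g(x) for a polynomial g with g(λ′) ≠ 0.  Polynomials are
  -- compared as functions, which is the same as comparing coefficients when
  -- R is an infinite field; the only use below is R = ℂ.
  HasAlgebraicMultiplicity : ∀ {n} → Matrix n n → Carrier → ℕ → Set (c ⊔ ℓ)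
  HasAlgebraicMultiplicity M λ′ m =
    ∃[ g ] (∀ x → charPoly M x ≈ (x - λ′) ^ m * evalPoly g x) × ¬ (evalPoly g λ′ ≈ 0#)

-- Block sizes p, then q repeated k times, then p repeated n/k - 1 times.
sizeF : (p q n k : ℕ) .{{_ : NonZero k}} → ℕ
sizeF p q n k = p ℕ.+ (k ℕ.* q ℕ.+ (n / k ℕ.∸ 1) ℕ.* p)

-- (n - n/k) p + (1 - k) q, which is nonnegative for q ≤ p: by totalSize below
-- the truncated subtraction loses nothing.
padding : (p q n k : ℕ) .{{_ : NonZero k}} → ℕ
padding p q n k = (n ℕ.∸ n / k) ℕ.* p ℕ.+ q ℕ.∸ k ℕ.* q

totalSize : ∀ p q n k .{{_ : NonZero n}} .{{_ : NonZero k}} → q ℕ.≤ p → k ∣ n →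
            sizeF p q n k ℕ.+ padding p q n k ≡ n ℕ.* p ℕ.+ q
totalSize p q n (suc k) q≤p (divides (suc d) refl) = begin
  sizeF p q n (suc k) ℕ.+ padding p q n (suc k)
    ≡⟨ cong (λ e → p ℕ.+ (suc k ℕ.* q ℕ.+ (e ℕ.∸ 1) ℕ.* p) ℕ.+ ((n ℕ.∸ e) ℕ.* p ℕ.+ q ℕ.∸ suc k ℕ.* q))
            (m*n/n≡m (suc d) (suc k)) ⟩
  p ℕ.+ (suc k ℕ.* q ℕ.+ d ℕ.* p) ℕ.+ ((n ℕ.∸ suc d) ℕ.* p ℕ.+ q ℕ.∸ suc k ℕ.* q)
    ≡⟨ cong (λ e → p ℕ.+ (suc k ℕ.* q ℕ.+ d ℕ.* p) ℕ.+ (e ℕ.* p ℕ.+ q ℕ.∸ suc k ℕ.* q)) n∸d ⟩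
  p ℕ.+ (suc k ℕ.* q ℕ.+ d ℕ.* p) ℕ.+ (suc d ℕ.* k ℕ.* p ℕ.+ q ℕ.∸ suc k ℕ.* q)
    ≡⟨ rearrange₁ p (suc k ℕ.* q) (d ℕ.* p) _ ⟩
  (p ℕ.+ d ℕ.* p) ℕ.+ (suc k ℕ.* q ℕ.+ (suc d ℕ.* k ℕ.* p ℕ.+ q ℕ.∸ suc k ℕ.* q))
    ≡⟨ cong (p ℕ.+ d ℕ.* p ℕ.+_) (ℕ.m+[n∸m]≡n kq≤) ⟩
  (p ℕ.+ d ℕ.* p) ℕ.+ (suc d ℕ.* k ℕ.* p ℕ.+ q)
    ≡⟨ rearrange₂ p q d k ⟩
  n ℕ.* p ℕ.+ q ∎
  where
  open ≡-Reasoning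

  rearrange₁ : ∀ a b c e → a ℕ.+ (b ℕ.+ c) ℕ.+ e ≡ (a ℕ.+ c) ℕ.+ (b ℕ.+ e)
  rearrange₁ = ℕ-Solver.solve-∀

  rearrange₂ : ∀ p q d k → (p ℕ.+ d ℕ.* p) ℕ.+ (suc d ℕ.* k ℕ.* p ℕ.+ q) ≡ suc d ℕ.* suc k ℕ.* p ℕ.+ q
  rearrange₂ = ℕ-Solver.solve-∀

  n∸d : suc d ℕ.* suc k ℕ.∸ suc d ≡ suc d ℕ.* k
  n∸d = ≡.trans (cong (ℕ._∸ suc d) (ℕ.*-suc (suc d) k)) (ℕ.m+n∸m≡n (suc d) (suc d ℕ.* k))

  kq≤ : suc k ℕ.* q ℕ.≤ suc d ℕ.* k ℕ.* p ℕ.+ q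
  kq≤ = ℕ.≤-trans (ℕ.≤-reflexive (ℕ.+-comm q (k ℕ.* q)))
          (ℕ.+-monoˡ-≤ q (ℕ.*-mono-≤ (ℕ.m≤n*m k (suc d)) q≤p))

module RealMatrices {c ℓ₁ ℓ₂} (ℝ : RealField c ℓ₁ ℓ₂) where

  open RealField ℝ
  open Matrices commutativeRing public using (Matrix; _≈ₘ_; 0ₘ; Iₘ; _⊕_; rowSum)

  complexField : CommutativeRing c ℓ₁
  complexField = complexRing commutativeRing

  private
    module ℂ = CommutativeRing complexField
    module Mℂ = Matrices complexField

  toℂ : ∀ {m n} → Matrix m n → Mℂ.Matrix m n
  toℂ M i j = M i j , 0#

  HasEigenvalueOfMultiplicity : ∀ {n} → Matrix n n → ℂ.Carrier → ℕ → Set (c ⊔ ℓ₁)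
  HasEigenvalueOfMultiplicity M λ′ m =
    Mℂ.IsEigenvalue (toℂ M) λ′ × Mℂ.HasAlgebraicMultiplicity (toℂ M) λ′ m

  -- The two sizes are separate parameters only because sizes that are equal
  -- numbers need not be definitionally equal.
  Cospectral : ∀ {m n} → Matrix m m → Matrix n n → Set (c ⊔ ℓ₁)
  Cospectral X Y =
    ∀ λ′ r → HasEigenvalueOfMultiplicity X λ′ r ⇔ HasEigenvalueOfMultiplicity Y λ′ r

  Nonnegative : ∀ {m n} → Matrix m n → Set ℓ₂
  Nonnegative M = ∀ i j → 0# ≤ M i j

  PositiveRowSums : ∀ {m n} → Matrix m n → Set ℓ₂
  PositiveRowSums M = ∀ i → 0# < rowSum M i

  -- y = x^(-1/2)
  IsInverseSqrt : Carrier → Carrier → Set (ℓ₁ ⊔ ℓ₂)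
  IsInverseSqrt x y = 0# < y × x * (y * y) ≈ 1#

  -- L = I - Δ^(-1/2) M Δ^(-1/2), where d is the diagonal of Δ^(-1/2).
  IsNormalizedLaplacian⁺ : ∀ {n} → Matrix n n → Matrix n n → Set (c ⊔ ℓ₁ ⊔ ℓ₂)
  IsNormalizedLaplacian⁺ {n} M L =
    PositiveRowSums M ×
    Σ[ d ∈ Vector Carrier n ] (∀ i → IsInverseSqrt (rowSum M i) (d i)) ×
      L ≈ₘ (λ i j → Iₘ n i j - d i * M i j * d j)

  permute : ∀ {m n} → Permutation m n → Matrix n n → Matrix m m
  permute σ M i j = M (σ ⟨$⟩ʳ i) (σ ⟨$⟩ʳ j)

  -- L = L(M), as a relation: choosing the decomposition M = M₁ ⊕ 0ₖ requires
  -- deciding which row sums vanish.  The case k = 0 is that of positive row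
  -- sums.
  record IsNormalizedLaplacian {n} (M L : Matrix n n) : Set (c ⊔ ℓ₁ ⊔ ℓ₂) where
    field
      r k        : ℕ
      σ          : Permutation (r ℕ.+ k) n
      M₁ L₁      : Matrix r r
      M-decomp   : permute σ M ≈ₘ M₁ ⊕ 0ₘ k
      L₁-isL[M₁] : IsNormalizedLaplacian⁺ M₁ L₁
      L-decomp   : permute σ L ≈ₘ L₁ ⊕ Iₘ k

  module _ {p q : ℕ} (n k : ℕ) .{{_ : NonZero k}} where

    -- inj₁ i: row i of a size-p block; inj₂ j: row j of a size-q block.
    position : Fin (sizeF p q n k) → Fin p ⊎ Fin q
    position = [ inj₁ , [ inj₂ ∘ remainder {k} q , inj₁ ∘ remainder {n / k ℕ.∸ 1} p ]′ ∘ splitAt (k ℕ.* q) ]′ ∘ splitAt p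

    F : Matrix p q → Matrix (sizeF p q n k) (sizeF p q n k)
    F B s t with position s | position t
    ... | inj₁ i | inj₂ j = B i j
    ... | inj₂ j | inj₁ i = B i j
    ... | inj₁ _ | inj₁ _ = 0#
    ... | inj₂ _ | inj₂ _ = 0#

{-# OPTIONS --safe #-}

-- With m = n / k, the row sums of F_k ⊕ 0 are k times those of B on the m
-- blocks of size p and m times those of Bᵀ on the k blocks of size q.  Hence the
-- row-normalised matrix, which is conjugate to Δ^(-1/2) M Δ^(-1/2), maps a vector
-- to one that is constant along copies of a row of B or Bᵀ and depends only on
-- the means over the copies: it is U C A, where A takes means, U copies (A U = 1)
-- and C = [ 0 C₁ ; C₂ 0 ] consists of B and Bᵀ with rows divided by their sums.
-- Taking means and deviations from them as coordinates, it is therefore similar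
-- to C ⊕ 0, in which only the size could depend on k, and does not.  Similarity
-- gives both halves of cospectrality: eigenvectors are transported, and
-- characteristic polynomials agree because det is multiplicative.

module Submission where

open import Defs
open import Algebra.Bundles using (CommutativeRing)
import Algebra.Properties.Ring as RingProperties
import Algebra.Properties.Semiring.Sum as SemiringSum
import Algebra.Solver.Ring.NaturalCoefficients.Default as RingSolver
open import Data.Fin.Base using (Fin; zero; suc; toℕ; punchIn; punchOut; lift; _↑ˡ_; _↑ʳ_; combine; splitAt)
import Data.Fin.Properties as Fin
open import Data.Fin.Permutation as Perm using (_⟨$⟩ʳ_; _⟨$⟩ˡ_)
open import Data.Maybe.Base using (Maybe; just; nothing)
open import Data.Nat.Base as ℕ using (ℕ; zero; suc; NonZero)
open import Data.Nat.Divisibility using (_∣_)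
open import Data.Nat.DivMod using (_/_)
import Data.Nat.Properties as ℕ
import Data.Nat.Tactic.RingSolver as ℕ-Solver
open import Data.Product.Base using (_×_; _,_; Σ-syntax; proj₂)
open import Data.Sum.Base using (_⊎_; inj₁; inj₂; [_,_]′)
open import Data.Sum.Function.Propositional using (_⊎-↔_)
open import Data.Unit.Polymorphic.Base using (⊤; tt)
open import Data.Vec.Functional using (Vector; _∷_; head; tail; insertAt; removeAt)
open import Data.Vec.Functional.Properties using (insertAt-lookup; insertAt-punchIn)
open import Function.Base using (_∘_)
open import Function.Bundles using (_↔_; Inverse; mk⇔)
open import Function.Definitions using (Injective)
open import Function.Properties.Inverse using (↔-refl; ↔-sym; ↔-trans)
open import Level using (_⊔_)
open import Relation.Binary.PropositionalEquality as ≡ using (_≡_; _≢_; _≗_)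
import Relation.Binary.Reasoning.Setoid as SetoidReasoning
open import Relation.Binary.Structures using (IsStrictPartialOrder)
open import Relation.Nullary.Decidable.Core using (yes; no)
open import Relation.Nullary.Negation.Core using (¬_; contradiction)

-- The decompositions `M₁ ⊕ 0ₖ` behind the two Laplacians are related neither to each other nor to
-- the block structure, and whether a row sum vanishes cannot be decided. Putting the scaling `d`
-- equal to 1 on the zero rows absorbs them: `L = I - D M D` then holds on all rows with `D`
-- invertible. From there on a zero row contributes only an arbitrary factor times a zero vector, so
-- `C₁` and `C₂` depend on `B` alone. Means and deviations live on nested sums and products of index
-- sets. Similarity is therefore studied for linear operators on functions over arbitrary types, and
-- becomes a statement about matrices only when the two Laplacians are compared. `det` is a Laplace
-- expansion over a commutative ring, where pivots cannot be chosen or divided by. Its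
-- multiplicativity comes instead from the fact that an alternating form is determined by its value
-- at the identity matrix. The similarity is real; it is carried to ℂ entry by entry.

module LinearAlgebra {c ℓ} (R : CommutativeRing c ℓ) where

  open CommutativeRing R hiding (zero)
  open Matrices R
  open RingProperties ring
  open SemiringSum semiring using (sum-cong-≋; ∑-distrib-+; ∑-comm; sum-replicate-zero; *-distribˡ-sum; *-distribʳ-sum)
  open RingSolver commutativeSemiring using (solve; _:=_; _:+_; _:*_; con)
  open SetoidReasoning setoid

  infix 4 _≈ᵥ_
  _≈ᵥ_ : ∀ {a} {I : Set a} → (I → Carrier) → (I → Carrier) → Set (a ⊔ ℓ)
  u ≈ᵥ v = ∀ i → u i ≈ v i

  sum-zero : ∀ {n} {f : Vector Carrier n} → (∀ i → f i ≈ 0#) → sum f ≈ 0#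
  sum-zero {n} f≈0 = trans (sum-cong-≋ f≈0) (sum-replicate-zero n)

  -- Identity matrices and linear maps.

  I-diag : ∀ {n} (i : Fin n) → Iₘ n i i ≈ 1#
  I-diag i with i Fin.≟ i
  ... | yes _  = refl
  ... | no i≢i = contradiction ≡.refl i≢i

  I-off-diag : ∀ {n} {i j : Fin n} → i ≢ j → Iₘ n i j ≈ 0#
  I-off-diag {i = i} {j} i≢j with i Fin.≟ j
  ... | yes i≡j = contradiction i≡j i≢j
  ... | no _    = refl

  I-injective : ∀ {m n} (φ : Fin m → Fin n) → Injective _≡_ _≡_ φ → ∀ i j → Iₘ n (φ i) (φ j) ≈ Iₘ m i j
  I-injective φ φ-inj i j with i Fin.≟ j
  ... | yes ≡.refl = I-diag (φ i)
  ... | no i≢j     = I-off-diag (i≢j ∘ φ-inj)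

  I-suc : ∀ {n} (i j : Fin n) → Iₘ (suc n) (suc i) (suc j) ≈ Iₘ n i j
  I-suc = I-injective suc Fin.suc-injective

  I-sym : ∀ {n} (i j : Fin n) → Iₘ n i j ≈ Iₘ n j i
  I-sym i j with i Fin.≟ j
  ... | yes ≡.refl = sym (I-diag i)
  ... | no i≢j     = sym (I-off-diag (i≢j ∘ ≡.sym))

  sum-I* : ∀ {n} (i : Fin n) (v : Vector Carrier n) → sum (λ j → Iₘ n i j * v j) ≈ v i
  sum-I* {suc n} zero v = begin
    1# * v zero + sum (λ j → Iₘ (suc n) zero (suc j) * v (suc j))  ≈⟨ +-cong (*-identityˡ _) (sum-zero λ j → zeroˡ (v (suc j))) ⟩
    v zero + 0#                                                    ≈⟨ +-identityʳ _ ⟩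
    v zero                                                         ∎
  sum-I* {suc n} (suc i) v = begin
    0# * v zero + sum (λ j → Iₘ (suc n) (suc i) (suc j) * v (suc j))  ≈⟨ +-cong (zeroˡ _) (sum-cong-≋ λ j → *-congʳ (I-suc i j)) ⟩
    0# + sum (λ j → Iₘ n i j * v (suc j))                             ≈⟨ +-identityˡ _ ⟩
    sum (λ j → Iₘ n i j * v (suc j))                                  ≈⟨ sum-I* i (v ∘ suc) ⟩
    v (suc i)                                                         ∎

  -- The index types are arbitrary because functions on nested sums and products occur below. The
  -- single law gives additivity for `a` = 1 and, with `zero-homo`, homogeneity.
  record IsLinear {a b} {I : Set a} {J : Set b} (T : (I → Carrier) → J → Carrier) : Set (a ⊔ b ⊔ c ⊔ ℓ) where
    field
      cong   : ∀ {u v} → u ≈ᵥ v → T u ≈ᵥ T v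
      linear : ∀ a u v → T (λ i → a * u i + v i) ≈ᵥ λ j → a * T u j + T v j

    zero-homo : ∀ {u} → u ≈ᵥ (λ _ → 0#) → T u ≈ᵥ λ _ → 0#
    zero-homo {u} u≈0 j = x+x≈x⇒x≈0 _ (begin
      T u j + T u j                ≈⟨ +-congʳ (*-identityˡ _) ⟨
      1# * T u j + T u j           ≈⟨ linear 1# u u j ⟨
      T (λ i → 1# * u i + u i) j   ≈⟨ cong (λ i → trans (+-cong (trans (*-identityˡ _) (u≈0 i)) refl) (+-identityˡ _)) j ⟩
      T u j                        ∎)

  0∷-isLinear : ∀ {n} → IsLinear {I = Fin n} (0# ∷_)
  0∷-isLinear = record
    { cong   = λ { u≈v zero → refl ; u≈v (suc i) → u≈v i }
    ; linear = λ { a u v zero → sym (trans (+-identityʳ _) (zeroʳ a)) ; a u v (suc i) → refl }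
    }

  ∘-isLinear : ∀ {a b d} {I : Set a} {J : Set b} {K : Set d}
               {S : (J → Carrier) → K → Carrier} {T : (I → Carrier) → J → Carrier} →
               IsLinear S → IsLinear T → IsLinear (S ∘ T)
  ∘-isLinear S-lin T-lin = record
    { cong   = λ u≈v → S.cong (T.cong u≈v)
    ; linear = λ a u v k → trans (S.cong (T.linear a u v) k) (S.linear a _ _ k)
    }
    where module S = IsLinear S-lin
          module T = IsLinear T-lin

  reindex-isLinear : ∀ {a b} {I : Set a} {J : Set b} (φ : J → I) → IsLinear (_∘ φ)
  reindex-isLinear φ = record { cong = λ u≈v j → u≈v (φ j) ; linear = λ a u v j → refl }

  -- Splitting off the first coordinate leaves a vector with leading zero, so the induction
  -- hypothesis is applied to `T` composed with `0# ∷_`.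
  linear-expand : ∀ {b} {J : Set b} {n} {T : (Fin n → Carrier) → J → Carrier} → IsLinear T →
                  ∀ u → T u ≈ᵥ λ j → sum (λ i → u i * T (Iₘ n i) j)
  linear-expand {n = zero}      T-lin u j = IsLinear.zero-homo T-lin (λ ()) j
  linear-expand {n = suc n} {T} T-lin u j = begin
    T u j
      ≈⟨ cong (λ { zero    → sym (trans (+-identityʳ _) (*-identityʳ _))
                 ; (suc i) → sym (trans (+-congʳ (zeroʳ _)) (+-identityˡ _)) }) j ⟩
    T (λ i → u zero * Iₘ (suc n) zero i + (0# ∷ tail u) i) j
      ≈⟨ linear _ _ _ j ⟩
    u zero * T (Iₘ (suc n) zero) j + T (0# ∷ tail u) j
      ≈⟨ +-congˡ (linear-expand (∘-isLinear T-lin 0∷-isLinear) (tail u) j) ⟩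
    u zero * T (Iₘ (suc n) zero) j + sum (λ i → u (suc i) * T (0# ∷ Iₘ n i) j)
      ≈⟨ +-congˡ (sum-cong-≋ λ i → *-congˡ (cong (λ { zero → refl ; (suc k) → sym (I-suc i k) }) j)) ⟩
    u zero * T (Iₘ (suc n) zero) j + sum (λ i → u (suc i) * T (Iₘ (suc n) (suc i)) j)
      ∎
    where open IsLinear T-lin

  infixl 7 _·_
  _·_ : ∀ {l m n} → Matrix l m → Matrix m n → Matrix l n
  (X · Y) i k = sum (λ j → X i j * Y j k)

  -- Alternating multilinear forms in the rows

  Form : ℕ → ℕ → Set c
  Form m n = Matrix m n → Carrier

  FirstTwoEqual⇒0 : ∀ {m n} → Form m n → Set (c ⊔ ℓ)
  FirstTwoEqual⇒0 {suc (suc m)} H = ∀ r N → H (r ∷ r ∷ N) ≈ 0#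
  FirstTwoEqual⇒0               H = ⊤

  -- The conditions concern only the leading rows but are imposed again after any leading row has
  -- been fixed. Together they amount to linearity in every row and vanishing on equal adjacent
  -- rows, in a form suited to induction on the number of rows.
  data Alternating {n} : ∀ {m} → Form m n → Set (c ⊔ ℓ) where
    nullary : {H : Form 0 n} → (∀ {M N} → M ≈ₘ N → H M ≈ H N) → Alternating H
    nonNullary : ∀ {m} {H : Form (suc m) n} →
                 (∀ {M N} → M ≈ₘ N → H M ≈ H N) →
                 (∀ a r s N → H ((λ j → a * r j + s j) ∷ N) ≈ a * H (r ∷ N) + H (s ∷ N)) →
                 FirstTwoEqual⇒0 H →
                 (∀ r → Alternating (λ N → H (r ∷ N))) →
                 Alternating H

  ∷-cong : ∀ {m n} {r s : Vector Carrier n} {M N : Matrix m n} → r ≈ᵥ s → M ≈ₘ N → r ∷ M ≈ₘ s ∷ N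
  ∷-cong r≈s M≈N zero    = r≈s
  ∷-cong r≈s M≈N (suc i) = M≈N i

  head∷tail : ∀ {m n} (M : Matrix (suc m) n) → M ≈ₘ head M ∷ tail M
  head∷tail M zero    j = refl
  head∷tail M (suc i) j = refl

  reflᵥ : ∀ {a} {I : Set a} {u : I → Carrier} → u ≈ᵥ u
  reflᵥ i = refl

  reflₘ : ∀ {m n} {M : Matrix m n} → M ≈ₘ M
  reflₘ i j = refl

  alternating-cong : ∀ {m n} {H : Form m n} → Alternating H → ∀ {M N} → M ≈ₘ N → H M ≈ H N
  alternating-cong (nullary H-cong)          = H-cong
  alternating-cong (nonNullary H-cong _ _ _) = H-cong

  alternating-linear : ∀ {m n} {H : Form (suc m) n} → Alternating H →
                       ∀ a r s N → H ((λ j → a * r j + s j) ∷ N) ≈ a * H (r ∷ N) + H (s ∷ N)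
  alternating-linear (nonNullary _ H-lin _ _) = H-lin

  alternating-firstTwo : ∀ {m n} {H : Form (suc m) n} → Alternating H → FirstTwoEqual⇒0 H
  alternating-firstTwo (nonNullary _ _ H-eq _) = H-eq

  alternating-tail : ∀ {m n} {H : Form (suc m) n} → Alternating H → ∀ r → Alternating (λ N → H (r ∷ N))
  alternating-tail (nonNullary _ _ _ H-tail) = H-tail

  firstTwoEqual-resp : ∀ {m n} {G H : Form m n} → (∀ M → G M ≈ H M) → FirstTwoEqual⇒0 G → FirstTwoEqual⇒0 H
  firstTwoEqual-resp {zero}        G≈H _  = tt
  firstTwoEqual-resp {suc zero}    G≈H _  = tt
  firstTwoEqual-resp {suc (suc m)} G≈H eq = λ r N → trans (sym (G≈H _)) (eq r N)

  alternating-resp : ∀ {m n} {G H : Form m n} → (∀ M → G M ≈ H M) → Alternating G → Alternating H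
  alternating-resp G≈H (nullary G-cong) = nullary λ M≈N → trans (sym (G≈H _)) (trans (G-cong M≈N) (G≈H _))
  alternating-resp {G = G} {H} G≈H (nonNullary G-cong G-lin G-eq G-tail) = nonNullary
    (λ M≈N → trans (sym (G≈H _)) (trans (G-cong M≈N) (G≈H _)))
    (λ a r s N → trans (sym (G≈H _)) (trans (G-lin a r s N) (+-cong (*-congˡ (G≈H _)) (G≈H _))))
    (firstTwoEqual-resp {G = G} {H} G≈H G-eq)
    (λ r → alternating-resp (λ N → G≈H (r ∷ N)) (G-tail r))

  mapRows : ∀ {m n n′} → (Vector Carrier n → Vector Carrier n′) → Matrix m n → Matrix m n′
  mapRows T M i = T (M i)

  module _ {n n′} {T : Vector Carrier n → Vector Carrier n′} (T-lin : IsLinear T) where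

    private module T = IsLinear T-lin

    mapRows-∷ : ∀ {m} r (N : Matrix m n) → mapRows T (r ∷ N) ≈ₘ T r ∷ mapRows T N
    mapRows-∷ r N zero    j = refl
    mapRows-∷ r N (suc i) j = refl

    firstTwoEqual-pullback : ∀ {m} {H : Form m n′} → Alternating H → FirstTwoEqual⇒0 H → FirstTwoEqual⇒0 (H ∘ mapRows T)
    firstTwoEqual-pullback {zero}        _   _  = tt
    firstTwoEqual-pullback {suc zero}    _   _  = tt
    firstTwoEqual-pullback {suc (suc m)} alt eq = λ r N →
      trans (alternating-cong alt (λ { zero → reflᵥ ; (suc i) → mapRows-∷ r N i })) (eq (T r) (mapRows T N))

    -- Covers every operation on columns used below: deleting a column, inserting a zero column, and
    -- multiplying by a matrix on the right.
    alternating-pullback : ∀ {m} {H : Form m n′} → Alternating H → Alternating (H ∘ mapRows T)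
    alternating-pullback (nullary H-cong) = nullary λ M≈N → H-cong λ i → T.cong (M≈N i)
    alternating-pullback {H = H} alt@(nonNullary H-cong H-lin H-eq H-tail) = nonNullary
      (λ M≈N → H-cong λ i → T.cong (M≈N i))
      (λ a r s N → begin
        H (mapRows T ((λ j → a * r j + s j) ∷ N))              ≈⟨ H-cong (mapRows-∷ _ N) ⟩
        H (T (λ j → a * r j + s j) ∷ mapRows T N)              ≈⟨ H-cong (∷-cong (T.linear a r s) reflₘ) ⟩
        H ((λ j → a * T r j + T s j) ∷ mapRows T N)            ≈⟨ H-lin a (T r) (T s) (mapRows T N) ⟩
        a * H (T r ∷ mapRows T N) + H (T s ∷ mapRows T N)      ≈⟨ +-cong (*-congˡ (H-cong (mapRows-∷ r N))) (H-cong (mapRows-∷ s N)) ⟨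
        a * H (mapRows T (r ∷ N)) + H (mapRows T (s ∷ N))      ∎)
      (firstTwoEqual-pullback alt H-eq)
      (λ r → alternating-resp (λ N → sym (H-cong (mapRows-∷ r N))) (alternating-pullback (H-tail (T r))))

  module _ {k} (a : Vector Carrier k) where

    firstTwoEqual-combination : ∀ {m n} {H : Fin k → Form m n} → (∀ i → FirstTwoEqual⇒0 (H i)) →
                                FirstTwoEqual⇒0 (λ M → sum (λ i → a i * H i M))
    firstTwoEqual-combination {zero}        _  = tt
    firstTwoEqual-combination {suc zero}    _  = tt
    firstTwoEqual-combination {suc (suc m)} eq = λ r N → sum-zero λ i → trans (*-congˡ (eq i r N)) (zeroʳ (a i))

    alternating-combination : ∀ {m n} {H : Fin k → Form m n} → (∀ i → Alternating (H i)) →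
                              Alternating (λ M → sum (λ i → a i * H i M))
    alternating-combination {zero} alt = nullary λ M≈N → sum-cong-≋ λ i → *-congˡ (alternating-cong (alt i) M≈N)
    alternating-combination {suc m} {H = H} alt = nonNullary
      (λ M≈N → sum-cong-≋ λ i → *-congˡ (alternating-cong (alt i) M≈N))
      (λ b r s N → begin
        sum (λ i → a i * H i ((λ j → b * r j + s j) ∷ N))
          ≈⟨ sum-cong-≋ (λ i → *-congˡ (alternating-linear (alt i) b r s N)) ⟩
        sum (λ i → a i * (b * H i (r ∷ N) + H i (s ∷ N)))
          ≈⟨ sum-cong-≋ (λ i → solve 4 (λ a b x y → a :* (b :* x :+ y) := b :* (a :* x) :+ a :* y) refl (a i) b _ _) ⟩
        sum (λ i → b * (a i * H i (r ∷ N)) + a i * H i (s ∷ N))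
          ≈⟨ ∑-distrib-+ (λ i → b * (a i * H i (r ∷ N))) (λ i → a i * H i (s ∷ N)) ⟩
        sum (λ i → b * (a i * H i (r ∷ N))) + sum (λ i → a i * H i (s ∷ N))
          ≈⟨ +-congʳ (*-distribˡ-sum b (λ i → a i * H i (r ∷ N))) ⟨
        b * sum (λ i → a i * H i (r ∷ N)) + sum (λ i → a i * H i (s ∷ N)) ∎)
      (firstTwoEqual-combination {H = H} λ i → alternating-firstTwo (alt i))
      (λ r → alternating-combination λ i → alternating-tail (alt i) r)

  -- The double sum in the expansion of det along two rows is indexed by pairs
  -- (j , k) standing for the columns j and punchIn j k; for j ≤ k the term
  -- exchanging the two columns is (suc k , j).
  Antisymmetric : ∀ {n} → (Fin (suc n) → Fin n → Carrier) → Set ℓ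
  Antisymmetric {zero}  G = ⊤
  Antisymmetric {suc n} G = (∀ k → G zero k + G (suc k) zero ≈ 0#) × Antisymmetric (λ j k → G (suc j) (suc k))

  antisymmetric-resp : ∀ {n} {G H : Fin (suc n) → Fin n → Carrier} → (∀ j k → G j k ≈ H j k) →
                       Antisymmetric G → Antisymmetric H
  antisymmetric-resp {zero}  G≈H _            = tt
  antisymmetric-resp {suc n} G≈H (cancel , G) =
    (λ k → trans (sym (+-cong (G≈H _ _) (G≈H _ _))) (cancel k)) , antisymmetric-resp (λ j k → G≈H (suc j) (suc k)) G

  sum-antisymmetric : ∀ {n} (G : Fin (suc n) → Fin n → Carrier) → Antisymmetric G → sum (λ j → sum (G j)) ≈ 0#
  sum-antisymmetric {zero}  G _ = +-identityʳ 0#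
  sum-antisymmetric {suc n} G (cancel , G′) = begin
    sum (G zero) + sum (λ j → G (suc j) zero + sum (G (suc j) ∘ suc))
      ≈⟨ +-congˡ (∑-distrib-+ (λ j → G (suc j) zero) (λ j → sum (G (suc j) ∘ suc))) ⟩
    sum (G zero) + (sum (λ j → G (suc j) zero) + sum (λ j → sum (G (suc j) ∘ suc)))
      ≈⟨ +-assoc _ _ _ ⟨
    sum (G zero) + sum (λ j → G (suc j) zero) + sum (λ j → sum (G (suc j) ∘ suc))
      ≈⟨ +-congʳ (∑-distrib-+ (G zero) (λ j → G (suc j) zero)) ⟨
    sum (λ k → G zero k + G (suc k) zero) + sum (λ j → sum (G (suc j) ∘ suc))
      ≈⟨ +-cong (sum-zero cancel) (sum-antisymmetric _ G′) ⟩
    0# + 0#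
      ≈⟨ +-identityʳ 0# ⟩
    0# ∎

  x+-1*x≈0 : ∀ x → x + - 1# * x ≈ 0#
  x+-1*x≈0 x = trans (+-congˡ (-1*x≈-x x)) (-‿inverseʳ x)

  -1*-1≈1 : - 1# * - 1# ≈ 1#
  -1*-1≈1 = trans (-1*x≈-x (- 1#)) (-‿involutive 1#)

  -- `D` stands for a minor as a function of the columns that remain. Removing two columns in either
  -- order leaves the same columns, while the total exponent of the sign changes by one.
  expansion-antisymmetric : ∀ {n} (r : Vector Carrier (2 ℕ.+ n)) (D : (Fin n → Fin (2 ℕ.+ n)) → Carrier) →
    (∀ {g h} → g ≗ h → D g ≈ D h) →
    Antisymmetric (λ j k → (- 1#) ^ toℕ j * r j * ((- 1#) ^ toℕ k * r (punchIn j k) * D (punchIn j ∘ punchIn k)))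
  expansion-antisymmetric {n} r D D-cong = cancel , rest n r D D-cong
    where
    cancel : ∀ k → 1# * r zero * ((- 1#) ^ toℕ k * r (suc k) * D (suc ∘ punchIn k)) +
                   - 1# * (- 1#) ^ toℕ k * r (suc k) * (1# * r zero * D (suc ∘ punchIn k)) ≈ 0#
    cancel k = trans
      (+-congˡ (solve 5 (λ s t a b d → s :* t :* b :* (con 1 :* a :* d) := s :* (con 1 :* a :* (t :* b :* d)))
                 refl (- 1#) ((- 1#) ^ toℕ k) (r zero) (r (suc k)) (D (suc ∘ punchIn k))))
      (x+-1*x≈0 _)

    rest : ∀ n (r : Vector Carrier (2 ℕ.+ n)) (D : (Fin n → Fin (2 ℕ.+ n)) → Carrier) →
           (∀ {g h} → g ≗ h → D g ≈ D h) →
           Antisymmetric (λ j k → (- 1#) ^ toℕ (suc j) * r (suc j) *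
             ((- 1#) ^ toℕ (suc k) * r (suc (punchIn j k)) * D (punchIn (suc j) ∘ punchIn (suc k))))
    rest zero    r D D-cong = tt
    rest (suc n) r D D-cong = antisymmetric-resp
      (λ j k → begin
        (- 1#) ^ toℕ j * r (suc j) * ((- 1#) ^ toℕ k * r (suc (punchIn j k)) * D (lift 1 (punchIn j ∘ punchIn k)))
          ≈⟨ *-identityˡ _ ⟨
        1# * ((- 1#) ^ toℕ j * r (suc j) * ((- 1#) ^ toℕ k * r (suc (punchIn j k)) * D (lift 1 (punchIn j ∘ punchIn k))))
          -- Shifting both columns by one adds two sign factors, whose product is 1. The two column
          -- selections agree only pointwise, hence the use of `D-cong`.
          ≈⟨ *-cong (sym -1*-1≈1) (*-congˡ (*-congˡ (D-cong λ { zero → ≡.refl ; (suc l) → ≡.refl }))) ⟩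
        - 1# * - 1# * ((- 1#) ^ toℕ j * r (suc j) * ((- 1#) ^ toℕ k * r (suc (punchIn j k)) * D (punchIn (suc j) ∘ punchIn (suc k))))
          ≈⟨ solve 6 (λ s t a u b d → s :* s :* (t :* a :* (u :* b :* d)) := s :* t :* a :* (s :* u :* b :* d))
               refl (- 1#) ((- 1#) ^ toℕ j) _ ((- 1#) ^ toℕ k) _ _ ⟩
        (- 1#) ^ toℕ (suc j) * r (suc j) * ((- 1#) ^ toℕ (suc k) * r (suc (punchIn j k)) * D (punchIn (suc j) ∘ punchIn (suc k)))
          ∎)
      (expansion-antisymmetric (r ∘ suc) (D ∘ lift 1) λ g≗h → D-cong λ { zero → ≡.refl ; (suc l) → ≡.cong suc (g≗h l) })

  det-alternating : ∀ n → Alternating {n} {n} det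
  det-alternating zero    = nullary λ _ → refl
  det-alternating (suc n) = nonNullary
    (λ M≈N → sum-cong-≋ λ j → *-cong (*-congˡ {x = (- 1#) ^ toℕ j} (M≈N zero j)) (det-cong λ i k → M≈N (suc i) (punchIn j k)))
    (λ a r s N → begin
      sum (λ j → (- 1#) ^ toℕ j * (a * r j + s j) * det (minor N j))
        ≈⟨ sum-cong-≋ (λ j → solve 5 (λ t a x y d → t :* (a :* x :+ y) :* d := a :* (t :* x :* d) :+ t :* y :* d)
                               refl ((- 1#) ^ toℕ j) a (r j) (s j) (det (minor N j))) ⟩
      sum (λ j → a * ((- 1#) ^ toℕ j * r j * det (minor N j)) + (- 1#) ^ toℕ j * s j * det (minor N j))
        ≈⟨ ∑-distrib-+ (λ j → a * ((- 1#) ^ toℕ j * r j * det (minor N j))) (λ j → (- 1#) ^ toℕ j * s j * det (minor N j)) ⟩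
      sum (λ j → a * ((- 1#) ^ toℕ j * r j * det (minor N j))) + det (s ∷ N)
        ≈⟨ +-congʳ (*-distribˡ-sum a (λ j → (- 1#) ^ toℕ j * r j * det (minor N j))) ⟨
      a * det (r ∷ N) + det (s ∷ N) ∎)
    (firstTwo n)
    -- With the first row fixed, `det` is a linear combination of smaller determinants, each pulled
    -- back along the deletion of a column.
    (λ r → alternating-combination (λ j → (- 1#) ^ toℕ j * r j)
             (λ j → alternating-pullback (reindex-isLinear (punchIn j)) (det-alternating n)))
    where
    det-cong : {M N : Matrix n n} → M ≈ₘ N → det M ≈ det N
    det-cong = alternating-cong (det-alternating n)

    minor : Matrix n (suc n) → Fin (suc n) → Matrix n n
    minor N j i k = N i (punchIn j k)

    -- Expanding along both leading rows gives a sum over ordered pairs of distinct columns; when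
    -- the rows are equal, the terms of exchanged pairs cancel.
    firstTwo : ∀ n → FirstTwoEqual⇒0 {suc n} det
    firstTwo zero    = tt
    firstTwo (suc n) = λ r N →
      let minor₂ : (Fin n → Fin (2 ℕ.+ n)) → Matrix n n
          minor₂ φ i l = N i (φ l)
          term : Fin (2 ℕ.+ n) → Fin (1 ℕ.+ n) → Carrier
          term j k = (- 1#) ^ toℕ k * r (punchIn j k) * det (minor₂ (punchIn j ∘ punchIn k))
      in trans
        (sum-cong-≋ λ j → *-distribˡ-sum ((- 1#) ^ toℕ j * r j) (term j))
        (sum-antisymmetric (λ j k → (- 1#) ^ toℕ j * r j * term j k)
          (expansion-antisymmetric r (det ∘ minor₂)
            λ g≗h → alternating-cong (det-alternating n) λ i l → reflexive (≡.cong (N i) (g≗h l))))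

  det-cong : ∀ {n} {M N : Matrix n n} → M ≈ₘ N → det M ≈ det N
  det-cong {n} = alternating-cong (det-alternating n)

  -- Polarisation: expand the zero value at two leading rows both equal to `r + s`. The factors `1#`
  -- come from the shape of the linearity law.
  alternating-swap : ∀ {m n} {H : Form (2 ℕ.+ m) n} → Alternating H → ∀ r s N → H (r ∷ s ∷ N) ≈ - H (s ∷ r ∷ N)
  alternating-swap {H = H} alt r s N = +-inverseˡ-unique _ _ (begin
    H (r ∷ s ∷ N) + H (s ∷ r ∷ N)
      ≈⟨ solve 2 (λ x y → x :+ y := con 1 :* (con 1 :* con 0 :+ x) :+ (con 1 :* y :+ con 0)) refl _ _ ⟩
    1# * (1# * 0# + H (r ∷ s ∷ N)) + (1# * H (s ∷ r ∷ N) + 0#)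
      ≈⟨ +-cong (*-congˡ (+-congʳ (*-congˡ (alternating-firstTwo alt r N)))) (+-congˡ (alternating-firstTwo alt s N)) ⟨
    1# * (1# * H (r ∷ r ∷ N) + H (r ∷ s ∷ N)) + (1# * H (s ∷ r ∷ N) + H (s ∷ s ∷ N))
      ≈⟨ +-cong (*-congˡ (alternating-linear (alternating-tail alt r) 1# r s N)) (alternating-linear (alternating-tail alt s) 1# r s N) ⟨
    1# * H (r ∷ t ∷ N) + H (s ∷ t ∷ N)
      ≈⟨ alternating-linear alt 1# r s (t ∷ N) ⟨
    H (t ∷ t ∷ N)
      ≈⟨ alternating-firstTwo alt t N ⟩
    0# ∎)
    where t = λ j → 1# * r j + s j

  -- Swapping `r` past the head of `N` and fixing that head brings the two equal rows one place
  -- closer, until they are adjacent.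
  alternating-repeated : ∀ {m n} {H : Form (suc m) n} → Alternating H →
                         ∀ {r N} i → N i ≈ᵥ r → H (r ∷ N) ≈ 0#
  alternating-repeated {H = H} alt {r} {N} zero Ni≈r = begin
    H (r ∷ N)           ≈⟨ alternating-cong alt (∷-cong reflᵥ λ { zero → Ni≈r ; (suc i) → reflᵥ }) ⟩
    H (r ∷ r ∷ tail N)  ≈⟨ alternating-firstTwo alt r (tail N) ⟩
    0#                  ∎
  alternating-repeated {H = H} alt {r} {N} (suc i) Ni≈r = begin
    H (r ∷ N)                   ≈⟨ alternating-cong alt (∷-cong reflᵥ (head∷tail N)) ⟩
    H (r ∷ head N ∷ tail N)     ≈⟨ alternating-swap alt r (head N) (tail N) ⟩
    - H (head N ∷ r ∷ tail N)   ≈⟨ -‿cong (alternating-repeated (alternating-tail alt (head N)) i Ni≈r) ⟩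
    - 0#                        ≈⟨ -0#≈0# ⟩
    0#                          ∎

  -- Row reduction without pivots: by linearity each row contributes a multiple of a form with `e`
  -- as one of its rows, which `kill` annihilates. In the application `H` already has `e` fixed as
  -- an earlier row.
  alternating-clear : ∀ {m n} {H : Form m n} → Alternating H →
    ∀ e → (∀ {N} i → N i ≈ᵥ e → H N ≈ 0#) →
    (T : Vector Carrier n → Vector Carrier n) (a : Vector Carrier n → Carrier) → (∀ r → r ≈ᵥ λ j → a r * e j + T r j) →
    ∀ N → H N ≈ H (mapRows T N)
  alternating-clear {zero} alt e kill T a split N = alternating-cong alt λ ()
  alternating-clear {suc m} {H = H} alt e kill T a split N = begin
    H N
      ≈⟨ alternating-cong alt (λ { zero → split (head N) ; (suc i) → reflᵥ }) ⟩
    H ((λ j → a (head N) * e j + T (head N) j) ∷ tail N)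
      ≈⟨ alternating-linear alt _ _ _ _ ⟩
    a (head N) * H (e ∷ tail N) + H (T (head N) ∷ tail N)
      ≈⟨ +-congʳ (trans (*-congˡ (kill zero reflᵥ)) (zeroʳ _)) ⟩
    0# + H (T (head N) ∷ tail N)
      ≈⟨ +-identityˡ _ ⟩
    H (T (head N) ∷ tail N)
      ≈⟨ alternating-clear (alternating-tail alt (T (head N))) e (λ i → kill (suc i)) T a split (tail N) ⟩
    H (T (head N) ∷ mapRows T (tail N))
      ≈⟨ alternating-cong alt (λ { zero → reflᵥ ; (suc i) → reflᵥ }) ⟩
    H (mapRows T N) ∎

  -- Uniqueness of alternating forms and multiplicativity of the determinant.

  insert0 : ∀ {n} → Fin (suc n) → Vector Carrier n → Vector Carrier (suc n)
  insert0 j u = insertAt u j 0#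

  data PunchView {n} (j : Fin (suc n)) : Fin (suc n) → Set where
    same    : PunchView j j
    punched : ∀ k → PunchView j (punchIn j k)

  punchView : ∀ {n} (j i : Fin (suc n)) → PunchView j i
  punchView j i with j Fin.≟ i
  ... | yes ≡.refl = same
  ... | no j≢i     = ≡.subst (PunchView j) (Fin.punchIn-punchOut j≢i) (punched (punchOut j≢i))

  insert0-same : ∀ {n} j (u : Vector Carrier n) → insert0 j u j ≈ 0#
  insert0-same j u = reflexive (insertAt-lookup u j 0#)

  insert0-punched : ∀ {n} j (u : Vector Carrier n) k → insert0 j u (punchIn j k) ≈ u k
  insert0-punched j u k = reflexive (insertAt-punchIn u j 0# k)

  insert0-isLinear : ∀ {n} (j : Fin (suc n)) → IsLinear (insert0 j)
  insert0-isLinear j = record { cong = cong ; linear = linear }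
    where
    cong : ∀ {u v} → u ≈ᵥ v → insert0 j u ≈ᵥ insert0 j v
    cong {u} {v} u≈v i with punchView j i
    ... | same      = trans (insert0-same j u) (sym (insert0-same j v))
    ... | punched k = trans (insert0-punched j u k) (trans (u≈v k) (sym (insert0-punched j v k)))

    linear : ∀ a u v → insert0 j (λ i → a * u i + v i) ≈ᵥ λ i → a * insert0 j u i + insert0 j v i
    linear a u v i with punchView j i
    ... | same      = trans (insert0-same j _) (sym (trans (+-cong (trans (*-congˡ (insert0-same j u)) (zeroʳ a)) (insert0-same j v)) (+-identityʳ 0#)))
    ... | punched k = trans (insert0-punched j _ k) (sym (+-cong (*-congˡ (insert0-punched j u k)) (insert0-punched j v k)))

  insert0-split : ∀ {n} (j : Fin (suc n)) u → u ≈ᵥ λ i → u j * Iₘ (suc n) j i + insert0 j (removeAt u j) i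
  insert0-split j u i with punchView j i
  ... | same      = sym (trans (+-cong (trans (*-congˡ (I-diag j)) (*-identityʳ _)) (insert0-same j _)) (+-identityʳ _))
  ... | punched k = sym (trans (+-cong (trans (*-congˡ (I-off-diag (Fin.punchInᵢ≢i j k ∘ ≡.sym))) (zeroʳ _)) (insert0-punched j _ k)) (+-identityˡ _))

  insert0-I : ∀ {n} (j : Fin (suc n)) i → insert0 j (Iₘ n i) ≈ᵥ Iₘ (suc n) (punchIn j i)
  insert0-I j i l with punchView j l
  ... | same      = trans (insert0-same j _) (sym (I-off-diag (Fin.punchInᵢ≢i j i)))
  ... | punched k = trans (insert0-punched j _ k) (sym (I-injective (punchIn j) (Fin.punchIn-injective j _ _) i k))

  -- The identity matrix with row `j` moved to the front, which is the permutation matrix of a cycle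
  -- of length `j` + 1.
  cycle : ∀ {n} → Fin (suc n) → Matrix (suc n) (suc n)
  cycle j = Iₘ _ j ∷ (λ i → Iₘ _ (punchIn j i))

  -- One swap brings the unit vector `Iₘ _ zero` to the front. With it fixed, the other rows form a
  -- shorter cycle in the columns after the first.
  alternating-cycle : ∀ {n} {H : Form (suc n) (suc n)} → Alternating H → ∀ j → H (cycle j) ≈ (- 1#) ^ toℕ j * H (Iₘ (suc n))
  alternating-cycle {H = H} alt zero = trans (alternating-cong alt λ { zero → reflᵥ ; (suc i) → reflᵥ }) (sym (*-identityˡ _))
  alternating-cycle {suc n} {H} alt (suc j) = begin
    H (Iₘ _ (suc j) ∷ (λ i → Iₘ _ (punchIn (suc j) i)))
      ≈⟨ alternating-cong alt (∷-cong reflᵥ (head∷tail _)) ⟩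
    H (Iₘ _ (suc j) ∷ Iₘ _ zero ∷ (λ i → Iₘ _ (suc (punchIn j i))))
      ≈⟨ alternating-swap alt _ _ _ ⟩
    - H (Iₘ _ zero ∷ Iₘ _ (suc j) ∷ (λ i → Iₘ _ (suc (punchIn j i))))
      ≈⟨ -‿cong (alternating-cong alt (∷-cong reflᵥ λ { zero → I-0∷ j ; (suc i) → I-0∷ (punchIn j i) })) ⟩
    - H (Iₘ _ zero ∷ mapRows (0# ∷_) (cycle j))
      ≈⟨ -‿cong (alternating-cycle (alternating-pullback 0∷-isLinear (alternating-tail alt (Iₘ _ zero))) j) ⟩
    - ((- 1#) ^ toℕ j * H (Iₘ _ zero ∷ mapRows (0# ∷_) (Iₘ _)))
      ≈⟨ -‿cong (*-congˡ (alternating-cong alt λ { zero → reflᵥ ; (suc i) k → sym (I-0∷ i k) })) ⟩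
    - ((- 1#) ^ toℕ j * H (Iₘ _))
      ≈⟨ -1*x≈-x _ ⟨
    - 1# * ((- 1#) ^ toℕ j * H (Iₘ _))
      ≈⟨ *-assoc _ _ _ ⟨
    - 1# * (- 1#) ^ toℕ j * H (Iₘ _) ∎
    where
    I-0∷ : ∀ {n} (i : Fin n) → Iₘ (suc n) (suc i) ≈ᵥ 0# ∷ Iₘ n i
    I-0∷ i zero    = refl
    I-0∷ i (suc k) = I-suc i k

  -- Laplace expansion along the first row holds for every alternating form:
  -- once that row is a unit vector, the rest of its column can be cleared.
  alternating-unique : ∀ {n} {H : Form n n} → Alternating H → ∀ M → H M ≈ H (Iₘ n) * det M
  alternating-unique {zero}      alt M = trans (alternating-cong alt λ ()) (sym (*-identityʳ _))
  alternating-unique {suc n} {H} alt M = begin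
    H M
      ≈⟨ alternating-cong alt (head∷tail M) ⟩
    H (r ∷ N)
      ≈⟨ linear-expand row-isLinear r tt ⟩
    sum (λ j → r j * H (Iₘ _ j ∷ N))
      ≈⟨ sum-cong-≋ (λ j → begin
           r j * H (Iₘ _ j ∷ N)                              ≈⟨ *-congˡ (cofactor j) ⟩
           r j * ((- 1#) ^ toℕ j * H (Iₘ _) * det (minor j)) ≈⟨ solve 4 (λ r s h d → r :* (s :* h :* d) := h :* (s :* r :* d)) refl _ _ _ _ ⟩
           H (Iₘ _) * ((- 1#) ^ toℕ j * r j * det (minor j)) ∎) ⟩
    sum (λ j → H (Iₘ _) * ((- 1#) ^ toℕ j * r j * det (minor j)))
      ≈⟨ *-distribˡ-sum (H (Iₘ _)) (λ j → (- 1#) ^ toℕ j * r j * det (minor j)) ⟨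
    H (Iₘ _) * det M ∎
    where
    r = head M
    N = tail M

    minor : Fin (suc n) → Matrix n n
    minor j i k = N i (punchIn j k)

    -- A scalar is treated as a function on a one-point type, so that `linear-expand` applies.
    row-isLinear : IsLinear {J = ⊤ {c}} (λ u _ → H (u ∷ N))
    row-isLinear = record
      { cong   = λ u≈v _ → alternating-cong alt (∷-cong u≈v reflₘ)
      ; linear = λ a u v _ → alternating-linear alt a u v N
      }

    cofactor : ∀ j → H (Iₘ _ j ∷ N) ≈ (- 1#) ^ toℕ j * H (Iₘ _) * det (minor j)
    cofactor j = begin
      H (Iₘ _ j ∷ N)
        ≈⟨ alternating-clear (alternating-tail alt (Iₘ _ j)) (Iₘ _ j) (alternating-repeated alt)
             (λ u → insert0 j (removeAt u j)) (λ u → u j) (insert0-split j) N ⟩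
      H (Iₘ _ j ∷ mapRows (insert0 j) (minor j))
        -- The cleared rows are the rows of the minor with a zero inserted in column `j`, so the
        -- value is an alternating form of a smaller square matrix.
        ≈⟨ alternating-unique (alternating-pullback (insert0-isLinear j) (alternating-tail alt (Iₘ _ j))) (minor j) ⟩
      H (Iₘ _ j ∷ mapRows (insert0 j) (Iₘ n)) * det (minor j)
        ≈⟨ *-congʳ (alternating-cong alt (∷-cong reflᵥ (insert0-I j))) ⟩
      H (cycle j) * det (minor j)
        ≈⟨ *-congʳ (alternating-cycle alt j) ⟩
      (- 1#) ^ toℕ j * H (Iₘ _) * det (minor j) ∎

  ·-isLinearˡ : ∀ {m n} (Y : Matrix m n) → IsLinear (λ u k → sum (λ j → u j * Y j k))
  ·-isLinearˡ Y = record
    { cong   = λ u≈v k → sum-cong-≋ λ j → *-congʳ (u≈v j)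
    ; linear = λ a u v k → begin
        sum (λ j → (a * u j + v j) * Y j k)
          ≈⟨ sum-cong-≋ (λ j → solve 4 (λ a u v y → (a :* u :+ v) :* y := a :* (u :* y) :+ v :* y) refl a (u j) (v j) (Y j k)) ⟩
        sum (λ j → a * (u j * Y j k) + v j * Y j k)
          ≈⟨ ∑-distrib-+ (λ j → a * (u j * Y j k)) (λ j → v j * Y j k) ⟩
        sum (λ j → a * (u j * Y j k)) + sum (λ j → v j * Y j k)
          ≈⟨ +-congʳ (*-distribˡ-sum a (λ j → u j * Y j k)) ⟨
        a * sum (λ j → u j * Y j k) + sum (λ j → v j * Y j k) ∎
    }

  -- As a function of `X` the left side is an alternating form whose value at the identity is
  -- `det Y`, so uniqueness gives the product.
  det-· : ∀ {n} (X Y : Matrix n n) → det (X · Y) ≈ det X * det Y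
  det-· {n} X Y = begin
    det (X · Y)            ≈⟨ alternating-unique (alternating-pullback (·-isLinearˡ Y) (det-alternating n)) X ⟩
    det (Iₘ n · Y) * det X ≈⟨ *-congʳ (det-cong λ i k → sum-I* i (λ j → Y j k)) ⟩
    det Y * det X          ≈⟨ *-comm _ _ ⟩
    det X * det Y          ∎

  det-I : ∀ n → det (Iₘ n) ≈ 1#
  det-I zero    = refl
  det-I (suc n) = begin
    1# * 1# * det (minor zero) + sum (λ j → (- 1#) ^ toℕ (suc j) * 0# * det (minor (suc j)))
      ≈⟨ +-cong (*-cong (*-identityʳ 1#) (trans (det-cong {M = minor zero} I-suc) (det-I n))) (sum-zero λ j → trans (*-congʳ (zeroʳ ((- 1#) ^ toℕ (suc j)))) (zeroˡ (det (minor (suc j))))) ⟩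
    1# * 1# + 0#
      ≈⟨ solve 0 (con 1 :* con 1 :+ con 0 := con 1) refl ⟩
    1# ∎
    where
    minor : Fin (suc n) → Matrix n n
    minor j i k = Iₘ (suc n) (suc i) (punchIn j k)

  -- Similarity

  sum-assoc : ∀ {m n} (u : Vector Carrier m) (X : Matrix m n) (v : Vector Carrier n) →
              sum (λ k → sum (λ j → u j * X j k) * v k) ≈ sum (λ j → u j * sum (λ k → X j k * v k))
  sum-assoc u X v = begin
    sum (λ k → sum (λ j → u j * X j k) * v k)   ≈⟨ sum-cong-≋ (λ k → *-distribʳ-sum (v k) (λ j → u j * X j k)) ⟩
    sum (λ k → sum (λ j → u j * X j k * v k))   ≈⟨ ∑-comm (λ k j → u j * X j k * v k) ⟩
    sum (λ j → sum (λ k → u j * X j k * v k))   ≈⟨ sum-cong-≋ (λ j → sum-cong-≋ λ k → *-assoc (u j) (X j k) (v k)) ⟩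
    sum (λ j → sum (λ k → u j * (X j k * v k))) ≈⟨ sum-cong-≋ (λ j → *-distribˡ-sum (u j) (λ k → X j k * v k)) ⟨
    sum (λ j → u j * sum (λ k → X j k * v k))   ∎

  ·-cong : ∀ {l m n} {X X′ : Matrix l m} {Y Y′ : Matrix m n} → X ≈ₘ X′ → Y ≈ₘ Y′ → X · Y ≈ₘ X′ · Y′
  ·-cong X≈X′ Y≈Y′ i k = sum-cong-≋ λ j → *-cong (X≈X′ i j) (Y≈Y′ j k)

  ·ᵥ-cong : ∀ {m n} {X X′ : Matrix m n} {v v′} → X ≈ₘ X′ → v ≈ᵥ v′ → X ·ᵥ v ≈ᵥ X′ ·ᵥ v′
  ·ᵥ-cong X≈X′ v≈v′ i = sum-cong-≋ λ j → *-cong (X≈X′ i j) (v≈v′ j)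

  ·ᵥ-assoc : ∀ {l m n} (X : Matrix l m) (Y : Matrix m n) v → (X · Y) ·ᵥ v ≈ᵥ X ·ᵥ (Y ·ᵥ v)
  ·ᵥ-assoc X Y v i = sum-assoc (X i) Y v

  ·ᵥ-* : ∀ {m n} (X : Matrix m n) a v → X ·ᵥ (λ j → a * v j) ≈ᵥ λ i → a * (X ·ᵥ v) i
  ·ᵥ-* X a v i = begin
    sum (λ j → X i j * (a * v j))  ≈⟨ sum-cong-≋ (λ j → solve 3 (λ x a v → x :* (a :* v) := a :* (x :* v)) refl (X i j) a (v j)) ⟩
    sum (λ j → a * (X i j * v j))  ≈⟨ *-distribˡ-sum a (λ j → X i j * v j) ⟨
    a * sum (λ j → X i j * v j)    ∎

  sum-*I : ∀ {n} (i : Fin n) (v : Vector Carrier n) → sum (λ j → v j * Iₘ n j i) ≈ v i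
  sum-*I i v = trans (sum-cong-≋ λ j → trans (*-comm _ _) (*-congʳ (I-sym j i))) (sum-I* i v)

  -- The sizes are separate because those compared are equal only propositionally; `P` is then not
  -- visibly square, and both inverse laws are demanded.
  record Similar {m n} (X : Matrix m m) (Y : Matrix n n) : Set (c ⊔ ℓ) where
    field
      P          : Matrix m n
      Q          : Matrix n m
      P·Q≈I      : P · Q ≈ₘ Iₘ m
      Q·P≈I      : Q · P ≈ₘ Iₘ n
      intertwine : X · P ≈ₘ P · Y

  similar-sym : ∀ {m n} {X : Matrix m m} {Y : Matrix n n} → Similar X Y → Similar Y X
  similar-sym {X = X} {Y} X~Y = record
    { P = Q ; Q = P ; P·Q≈I = Q·P≈I ; Q·P≈I = P·Q≈I
    ; intertwine = λ i k → begin
        (Y · Q) i k              ≈⟨ sum-I* i (λ j → (Y · Q) j k) ⟨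
        (Iₘ _ · (Y · Q)) i k     ≈⟨ ·-cong {Y = Y · Q} Q·P≈I reflₘ i k ⟨
        ((Q · P) · (Y · Q)) i k  ≈⟨ sum-assoc (Q i) P (λ j → (Y · Q) j k) ⟩
        (Q · (P · (Y · Q))) i k  ≈⟨ ·-cong {X = Q} reflₘ (λ j k → sum-assoc (P j) Y (λ l → Q l k)) i k ⟨
        (Q · ((P · Y) · Q)) i k  ≈⟨ ·-cong {X = Q} reflₘ (·-cong {Y = Q} intertwine reflₘ) i k ⟨
        (Q · ((X · P) · Q)) i k  ≈⟨ ·-cong {X = Q} reflₘ (λ j k → sum-assoc (X j) P (λ l → Q l k)) i k ⟩
        (Q · (X · (P · Q))) i k  ≈⟨ ·-cong {X = Q} reflₘ (·-cong {X = X} reflₘ P·Q≈I) i k ⟩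
        (Q · (X · Iₘ _)) i k     ≈⟨ ·-cong {X = Q} reflₘ (λ j k → sum-*I k (X j)) i k ⟩
        (Q · X) i k              ∎
    }
    where open Similar X~Y

  similar-isEigenvalue : ∀ {m n} {X : Matrix m m} {Y : Matrix n n} → Similar X Y →
                         ∀ {μ} → IsEigenvalue Y μ → IsEigenvalue X μ
  similar-isEigenvalue {X = X} {Y} X~Y {μ} (v , v≉0 , Yv≈μv) = P ·ᵥ v , Pv≉0 , λ i → begin
      (X ·ᵥ P ·ᵥ v) i             ≈⟨ ·ᵥ-assoc X P v i ⟨
      ((X · P) ·ᵥ v) i            ≈⟨ ·ᵥ-cong {v = v} intertwine reflᵥ i ⟩
      ((P · Y) ·ᵥ v) i            ≈⟨ ·ᵥ-assoc P Y v i ⟩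
      (P ·ᵥ Y ·ᵥ v) i             ≈⟨ ·ᵥ-cong {X = P} reflₘ Yv≈μv i ⟩
      (P ·ᵥ (λ j → μ * v j)) i    ≈⟨ ·ᵥ-* P μ v i ⟩
      μ * (P ·ᵥ v) i              ∎
    where
    open Similar X~Y
    Pv≉0 : ¬ (∀ i → (P ·ᵥ v) i ≈ 0#)
    Pv≉0 Pv≈0 = v≉0 λ i → begin
      v i                 ≈⟨ sum-I* i v ⟨
      (Iₘ _ ·ᵥ v) i       ≈⟨ ·ᵥ-cong {v = v} Q·P≈I reflᵥ i ⟨
      ((Q · P) ·ᵥ v) i    ≈⟨ ·ᵥ-assoc Q P v i ⟩
      (Q ·ᵥ P ·ᵥ v) i     ≈⟨ sum-zero (λ j → trans (*-congˡ (Pv≈0 j)) (zeroʳ _)) ⟩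
      0#                  ∎

  -- Take determinants in `(x I - X) P = P (x I - Y)`. Multiplying by `det P * det Q`, which is 1,
  -- replaces division by `det P`.
  similar-charPoly : ∀ {n} {X Y : Matrix n n} → Similar X Y → ∀ x → charPoly X x ≈ charPoly Y x
  similar-charPoly {n} {X} {Y} X~Y x = begin
    det x-X                        ≈⟨ *-identityʳ _ ⟨
    det x-X * 1#                   ≈⟨ *-congˡ detP*detQ≈1 ⟨
    det x-X * (det P * det Q)      ≈⟨ *-assoc _ _ _ ⟨
    det x-X * det P * det Q        ≈⟨ *-congʳ (det-· x-X P) ⟨
    det (x-X · P) * det Q          ≈⟨ *-congʳ (det-cong x-X·P≈P·x-Y) ⟩
    det (P · x-Y) * det Q          ≈⟨ *-congʳ (det-· P x-Y) ⟩
    det P * det x-Y * det Q        ≈⟨ solve 3 (λ p y q → p :* y :* q := y :* (p :* q)) refl _ _ _ ⟩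
    det x-Y * (det P * det Q)      ≈⟨ *-congˡ detP*detQ≈1 ⟩
    det x-Y * 1#                   ≈⟨ *-identityʳ _ ⟩
    det x-Y                        ∎
    where
    open Similar X~Y
    x-X x-Y : Matrix n n
    x-X i j = x * Iₘ n i j - X i j
    x-Y i j = x * Iₘ n i j - Y i j

    detP*detQ≈1 : det P * det Q ≈ 1#
    detP*detQ≈1 = trans (sym (det-· P Q)) (trans (det-cong P·Q≈I) (det-I n))

    x-X·P≈P·x-Y : x-X · P ≈ₘ P · x-Y
    x-X·P≈P·x-Y i k = begin
      sum (λ j → (x * Iₘ n i j - X i j) * P j k)
        ≈⟨ sum-cong-≋ (λ j → begin
             (x * Iₘ n i j - X i j) * P j k              ≈⟨ [y-z]x≈yx-zx (P j k) (x * Iₘ n i j) (X i j) ⟩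
             x * Iₘ n i j * P j k - X i j * P j k        ≈⟨ +-cong (*-assoc _ _ _) (sym (-1*x≈-x _)) ⟩
             x * (Iₘ n i j * P j k) + - 1# * (X i j * P j k) ∎) ⟩
      sum (λ j → x * (Iₘ n i j * P j k) + - 1# * (X i j * P j k))
        ≈⟨ sum-combination (λ j → Iₘ n i j * P j k) (λ j → X i j * P j k) ⟩
      x * sum (λ j → Iₘ n i j * P j k) + - 1# * (X · P) i k
        ≈⟨ +-cong (*-congˡ (trans (sum-I* i (λ j → P j k)) (sym (sum-*I k (P i))))) (*-congˡ (intertwine i k)) ⟩
      x * sum (λ j → P i j * Iₘ n j k) + - 1# * (P · Y) i k
        ≈⟨ sum-combination (λ j → P i j * Iₘ n j k) (λ j → P i j * Y j k) ⟨
      sum (λ j → x * (P i j * Iₘ n j k) + - 1# * (P i j * Y j k))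
        ≈⟨ sum-cong-≋ (λ j → begin
             x * (P i j * Iₘ n j k) + - 1# * (P i j * Y j k)
               ≈⟨ solve 5 (λ x p e s y → x :* (p :* e) :+ s :* (p :* y) := p :* (x :* e :+ s :* y)) refl x (P i j) (Iₘ n j k) (- 1#) (Y j k) ⟩
             P i j * (x * Iₘ n j k + - 1# * Y j k)
               ≈⟨ *-congˡ (+-congˡ (-1*x≈-x _)) ⟩
             P i j * (x * Iₘ n j k - Y j k) ∎) ⟩
      sum (λ j → P i j * (x * Iₘ n j k - Y j k)) ∎
      where
      sum-combination : ∀ (f g : Vector Carrier n) → sum (λ j → x * f j + - 1# * g j) ≈ x * sum f + - 1# * sum g
      sum-combination f g = trans (∑-distrib-+ (λ j → x * f j) (λ j → - 1# * g j))
                      (sym (+-cong (*-distribˡ-sum x f) (*-distribˡ-sum (- 1#) g)))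

  -- Similarity of linear operators on functions.

  Operator : ∀ {a} → Set a → Set (a ⊔ c)
  Operator I = (I → Carrier) → I → Carrier

  -- A change of coordinates between arbitrary index types. Intertwining is asked in one direction
  -- only; `operatorSimilar-sym` recovers the other from the inverse laws.
  record OperatorSimilar {a b} {I : Set a} {J : Set b} (S : Operator I) (T : Operator J) : Set (a ⊔ b ⊔ c ⊔ ℓ) where
    field
      to            : (I → Carrier) → J → Carrier
      from          : (J → Carrier) → I → Carrier
      to-isLinear   : IsLinear to
      from-isLinear : IsLinear from
      from-to       : ∀ u → from (to u) ≈ᵥ u
      to-from       : ∀ v → to (from v) ≈ᵥ v
      to-intertwine : ∀ u → to (S u) ≈ᵥ T (to u)

  operatorSimilar-sym : ∀ {a b} {I : Set a} {J : Set b} {S : Operator I} {T : Operator J} →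
                        (∀ {u v} → u ≈ᵥ v → T u ≈ᵥ T v) →
                        OperatorSimilar S T → OperatorSimilar T S
  operatorSimilar-sym {S = S} {T} T-cong S~T = record
    { to = from ; from = to ; to-isLinear = from-isLinear ; from-isLinear = to-isLinear
    ; from-to = to-from ; to-from = from-to
    ; to-intertwine = λ v i → begin
        from (T v) i              ≈⟨ IsLinear.cong from-isLinear (T-cong (to-from v)) i ⟨
        from (T (to (from v))) i  ≈⟨ IsLinear.cong from-isLinear (to-intertwine (from v)) i ⟨
        from (to (S (from v))) i  ≈⟨ from-to (S (from v)) i ⟩
        S (from v) i              ∎
    }
    where open OperatorSimilar S~T

  operatorSimilar-trans : ∀ {a b d} {I : Set a} {J : Set b} {K : Set d}
                          {S : Operator I} {T : Operator J} {U : Operator K} →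
                          OperatorSimilar S T → OperatorSimilar T U → OperatorSimilar S U
  operatorSimilar-trans S~T T~U = record
    { to            = T~U.to ∘ S~T.to
    ; from          = S~T.from ∘ T~U.from
    ; to-isLinear   = ∘-isLinear T~U.to-isLinear S~T.to-isLinear
    ; from-isLinear = ∘-isLinear S~T.from-isLinear T~U.from-isLinear
    ; from-to       = λ u i → trans (IsLinear.cong S~T.from-isLinear (T~U.from-to (S~T.to u)) i) (S~T.from-to u i)
    ; to-from       = λ v k → trans (IsLinear.cong T~U.to-isLinear (S~T.to-from (T~U.from v)) k) (T~U.to-from v k)
    ; to-intertwine = λ u k → trans (IsLinear.cong T~U.to-isLinear (S~T.to-intertwine u) k) (T~U.to-intertwine (S~T.to u) k)
    }
    where
    module S~T = OperatorSimilar S~T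
    module T~U = OperatorSimilar T~U

  -- The order is reversed because `to` leads from the space of `Y` to that of `X`, and its matrix
  -- is the `P` with `X P = P Y`.
  operatorSimilar⇒similar : ∀ {m n} {X : Matrix m m} {Y : Matrix n n} →
                            OperatorSimilar (Y ·ᵥ_) (X ·ᵥ_) → Similar X Y
  operatorSimilar⇒similar {m} {n} {X} {Y} Y~X = record
    { P = matrix to ; Q = matrix from
    ; P·Q≈I = inverse to-isLinear to-from
    ; Q·P≈I = inverse from-isLinear from-to
    ; intertwine = λ i k → begin
        (X ·ᵥ to (Iₘ n k)) i                        ≈⟨ to-intertwine (Iₘ n k) i ⟨
        to (Y ·ᵥ Iₘ n k) i                          ≈⟨ expand to-isLinear (Y ·ᵥ Iₘ n k) i ⟩
        sum (λ j → matrix to i j * (Y ·ᵥ Iₘ n k) j) ≈⟨ sum-cong-≋ (λ j → *-congˡ (trans (sum-cong-≋ λ l → *-comm (Y j l) (Iₘ n k l)) (sum-I* k (Y j)))) ⟩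
        (matrix to · Y) i k                         ∎
    }
    where
    open OperatorSimilar Y~X

    matrix : ∀ {m n} → (Vector Carrier n → Vector Carrier m) → Matrix m n
    matrix f i j = f (Iₘ _ j) i

    expand : ∀ {m n} {f : Vector Carrier n → Vector Carrier m} → IsLinear f → ∀ u → f u ≈ᵥ matrix f ·ᵥ u
    expand f-lin u i = trans (linear-expand f-lin u i) (sum-cong-≋ λ j → *-comm (u j) _)

    inverse : ∀ {m n} {f : Vector Carrier n → Vector Carrier m} {g : Vector Carrier m → Vector Carrier n} →
              IsLinear f → (∀ v → f (g v) ≈ᵥ v) → matrix f · matrix g ≈ₘ Iₘ m
    inverse {m} {g = g} f-lin fg i k = trans (sym (expand f-lin (g (Iₘ m k)) i)) (trans (fg (Iₘ m k) i) (I-sym k i))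

  operatorSimilar-resp : ∀ {a b} {I : Set a} {J : Set b} {S S′ : Operator I} {T T′ : Operator J} →
                         (∀ u → S u ≈ᵥ S′ u) → (∀ v → T v ≈ᵥ T′ v) → OperatorSimilar S T → OperatorSimilar S′ T′
  operatorSimilar-resp S≈S′ T≈T′ S~T = record
    { to = to ; from = from ; to-isLinear = to-isLinear ; from-isLinear = from-isLinear
    ; from-to = from-to ; to-from = to-from
    ; to-intertwine = λ u j → trans (sym (IsLinear.cong to-isLinear (S≈S′ u) j)) (trans (to-intertwine u j) (T≈T′ (to u) j))
    }
    where open OperatorSimilar S~T

  operatorSimilar-id- : ∀ {a b} {I : Set a} {J : Set b} {S : Operator I} {T : Operator J} →
                        OperatorSimilar S T → OperatorSimilar (λ u i → u i - S u i) (λ v j → v j - T v j)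
  operatorSimilar-id- {S = S} {T} S~T = record
    { to = to ; from = from ; to-isLinear = to-isLinear ; from-isLinear = from-isLinear
    ; from-to = from-to ; to-from = to-from
    ; to-intertwine = λ u j → begin
        to (λ i → u i - S u i) j            ≈⟨ IsLinear.cong to-isLinear (λ i → trans (+-comm _ _) (+-congʳ (sym (-1*x≈-x _)))) j ⟩
        to (λ i → - 1# * S u i + u i) j     ≈⟨ IsLinear.linear to-isLinear (- 1#) (S u) u j ⟩
        - 1# * to (S u) j + to u j          ≈⟨ +-congʳ (trans (-1*x≈-x _) (-‿cong (to-intertwine u j))) ⟩
        - T (to u) j + to u j               ≈⟨ +-comm _ _ ⟩
        to u j - T (to u) j                 ∎
    }
    where open OperatorSimilar S~T

  operatorSimilar-reindex : ∀ {a b} {I : Set a} {J : Set b} (φ : I ↔ J) (S : Operator I) → (∀ {u v} → u ≈ᵥ v → S u ≈ᵥ S v) →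
                            OperatorSimilar S (λ v → S (v ∘ Inverse.to φ) ∘ Inverse.from φ)
  operatorSimilar-reindex φ S S-cong = record
    { to = _∘ φ.from ; from = _∘ φ.to
    ; to-isLinear = reindex-isLinear φ.from ; from-isLinear = reindex-isLinear φ.to
    ; from-to = λ u i → reflexive (≡.cong u (φ.strictlyInverseʳ i))
    ; to-from = λ v j → reflexive (≡.cong v (φ.strictlyInverseˡ j))
    ; to-intertwine = λ u j → S-cong (λ i → reflexive (≡.cong u (≡.sym (φ.strictlyInverseʳ i)))) (φ.from j)
    }
    where module φ = Inverse φ

  operatorSimilar-scale : ∀ {a} {I : Set a} (d d⁻¹ : I → Carrier) → (∀ i → d i * d⁻¹ i ≈ 1#) →
                          {S T : Operator I} → (∀ u i → d i * S u i ≈ T (λ j → d j * u j) i) → OperatorSimilar S T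
  operatorSimilar-scale d d⁻¹ d*d⁻¹≈1 intertwine = record
    { to = λ u i → d i * u i ; from = λ v i → d⁻¹ i * v i
    ; to-isLinear = scale-isLinear d ; from-isLinear = scale-isLinear d⁻¹
    ; from-to = λ u i → cancel (trans (*-comm _ _) (d*d⁻¹≈1 i))
    ; to-from = λ v i → cancel (d*d⁻¹≈1 i)
    ; to-intertwine = intertwine
    }
    where
    scale-isLinear : ∀ d → IsLinear (λ u i → d i * u i)
    scale-isLinear d = record
      { cong   = λ u≈v i → *-congˡ (u≈v i)
      ; linear = λ a u v i → solve 4 (λ d a u v → d :* (a :* u :+ v) := a :* (d :* u) :+ d :* v) refl (d i) a (u i) (v i)
      }
    cancel : ∀ {x y z} → x * y ≈ 1# → x * (y * z) ≈ z
    cancel xy≈1 = trans (sym (*-assoc _ _ _)) (trans (*-congʳ xy≈1) (*-identityˡ _))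

  -- Averages over blocks

  card : ℕ → Carrier
  card n = sum {n} (λ _ → 1#)

  sum-const : ∀ n x → sum {n} (λ _ → x) ≈ card n * x
  sum-const n x = trans (sum-cong-≋ {n} λ _ → sym (*-identityˡ x)) (sym (*-distribʳ-sum {n} x (λ _ → 1#)))

  sum-- : ∀ {n} (f g : Vector Carrier n) → sum (λ i → f i - g i) ≈ sum f - sum g
  sum-- f g = begin
    sum (λ i → f i - g i)              ≈⟨ ∑-distrib-+ f (λ i → - g i) ⟩
    sum f + sum (λ i → - g i)          ≈⟨ +-congˡ (sum-cong-≋ λ i → -1*x≈-x (g i)) ⟨
    sum f + sum (λ i → - 1# * g i)     ≈⟨ +-congˡ (*-distribˡ-sum (- 1#) g) ⟨
    sum f + - 1# * sum g               ≈⟨ +-congˡ (-1*x≈-x _) ⟩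
    sum f - sum g                      ∎

  -- `h` is the reciprocal of the number of entries, taken as a hypothesis so that averaging makes
  -- sense over any commutative ring.
  module Mean {m} {h : Carrier} (h*m≈1 : h * card (suc m) ≈ 1#) where

    mean : Vector Carrier (suc m) → Carrier
    mean v = h * sum v

    mean-cong : ∀ {u v} → u ≈ᵥ v → mean u ≈ mean v
    mean-cong u≈v = *-congˡ (sum-cong-≋ u≈v)

    mean-linear : ∀ a u v → mean (λ i → a * u i + v i) ≈ a * mean u + mean v
    mean-linear a u v = begin
      h * sum (λ i → a * u i + v i)         ≈⟨ *-congˡ (∑-distrib-+ (λ i → a * u i) v) ⟩
      h * (sum (λ i → a * u i) + sum v)     ≈⟨ *-congˡ (+-congʳ (*-distribˡ-sum a u)) ⟨
      h * (a * sum u + sum v)               ≈⟨ solve 4 (λ h a u v → h :* (a :* u :+ v) := a :* (h :* u) :+ h :* v) refl h a _ _ ⟩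
      a * (h * sum u) + h * sum v           ∎

    mean-const : ∀ x → mean (λ _ → x) ≈ x
    mean-const x = begin
      h * sum {suc m} (λ _ → x)  ≈⟨ *-congˡ (sum-const (suc m) x) ⟩
      h * (card (suc m) * x)     ≈⟨ *-assoc _ _ _ ⟨
      h * card (suc m) * x       ≈⟨ *-congʳ h*m≈1 ⟩
      1# * x                     ≈⟨ *-identityˡ x ⟩
      x                          ∎

    -- Recovers a vector from its mean `w` and its deviations `r` at all entries but the first.
    -- Deviations sum to zero, so the missing one is `- sum r`.
    restore : Carrier → Vector Carrier m → Vector Carrier (suc m)
    restore w r zero    = w - sum r
    restore w r (suc a) = w + r a

    mean-restore : ∀ w r → mean (restore w r) ≈ w
    mean-restore w r = trans (*-congˡ (begin
      (w - sum r) + sum (λ a → w + r a)                ≈⟨ +-congˡ (∑-distrib-+ (λ _ → w) r) ⟩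
      (w - sum r) + (sum {m} (λ _ → w) + sum r)        ≈⟨ solve 4 (λ w n s r → (w :+ n) :+ (s :+ r) := (w :+ s) :+ (n :+ r)) refl w (- sum r) _ _ ⟩
      (w + sum {m} (λ _ → w)) + (- sum r + sum r)      ≈⟨ +-congˡ (-‿inverseˡ _) ⟩
      sum {suc m} (λ _ → w) + 0#                       ≈⟨ +-identityʳ _ ⟩
      sum {suc m} (λ _ → w)                            ∎)) (mean-const w)

    sum-mean : ∀ v → sum {suc m} (λ _ → mean v) ≈ sum v
    sum-mean v = begin
      sum {suc m} (λ _ → mean v)   ≈⟨ sum-const (suc m) (mean v) ⟩
      card (suc m) * (h * sum v)   ≈⟨ solve 3 (λ c h s → c :* (h :* s) := h :* c :* s) refl _ h _ ⟩
      h * card (suc m) * sum v     ≈⟨ *-congʳ h*m≈1 ⟩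
      1# * sum v                   ≈⟨ *-identityˡ _ ⟩
      sum v                        ∎

    restore-mean : ∀ v → restore (mean v) (λ a → v (suc a) - mean v) ≈ᵥ v
    restore-mean v zero = begin
      w - sum (λ a → v (suc a) - w)                       ≈⟨ +-congˡ (-‿cong (sum-- (tail v) (λ _ → w))) ⟩
      w - (sum (tail v) - sum {m} (λ _ → w))              ≈⟨ +-congˡ (⁻¹-anti-homo-// _ _) ⟩
      w + (sum {m} (λ _ → w) - sum (tail v))              ≈⟨ +-assoc _ _ _ ⟨
      sum {suc m} (λ _ → w) - sum (tail v)                ≈⟨ +-congʳ (sum-mean v) ⟩
      v zero + sum (tail v) - sum (tail v)                ≈⟨ //-rightDividesʳ _ _ ⟩
      v zero                                              ∎
      where w = mean v
    restore-mean v (suc a) = trans (+-comm _ _) (//-rightDividesˡ _ _)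

-- The block graph and its row-normalised matrix.

module Blocks {c ℓ} (R : CommutativeRing c ℓ) where

  open CommutativeRing R hiding (zero)
  open Matrices R
  open RingProperties ring
  open SemiringSum semiring using (sum-cong-≋; ∑-distrib-+; ∑-comm; *-distribˡ-sum; *-distribʳ-sum)
  open RingSolver commutativeSemiring using (solve; _:=_; _:+_; _:*_)
  open SetoidReasoning setoid
  open LinearAlgebra R

  sum-↑ : ∀ m {n} (f : Vector Carrier (m ℕ.+ n)) → sum f ≈ sum (λ i → f (i ↑ˡ n)) + sum (λ j → f (m ↑ʳ j))
  sum-↑ zero    f = sym (+-identityˡ _)
  sum-↑ (suc m) f = trans (+-congˡ (sum-↑ m (f ∘ suc))) (sym (+-assoc _ _ _))

  sum-combine : ∀ m {n} (f : Vector Carrier (m ℕ.* n)) → sum f ≈ sum (λ i → sum (λ j → f (combine {m} i j)))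
  sum-combine zero        f = refl
  sum-combine (suc m) {n} f = trans (sum-↑ n f) (+-congˡ (sum-combine m (f ∘ (n ↑ʳ_))))

  -- e = 1 / sum b, unless b vanishes, when e is arbitrary
  Normalises : ∀ {n} → Vector Carrier n → Carrier → Set ℓ
  Normalises b e = (∀ j → b j ≈ 0#) ⊎ (sum b * e ≈ 1#)

  -- Inverses of `sum b` are unique, and where `b` vanishes both products do. This is what frees the
  -- reduced operator from the choices made on zero rows.
  normalises-unique : ∀ {n} {b : Vector Carrier n} {e e′} → Normalises b e → Normalises b e′ → ∀ j → e * b j ≈ e′ * b j
  normalises-unique (inj₁ b≈0) _ j = trans (trans (*-congˡ (b≈0 j)) (zeroʳ _)) (sym (trans (*-congˡ (b≈0 j)) (zeroʳ _)))
  normalises-unique (inj₂ _) (inj₁ b≈0) j = trans (trans (*-congˡ (b≈0 j)) (zeroʳ _)) (sym (trans (*-congˡ (b≈0 j)) (zeroʳ _)))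
  normalises-unique {b = b} {e} {e′} (inj₂ be≈1) (inj₂ be′≈1) j = *-congʳ (begin
    e                    ≈⟨ *-identityʳ e ⟨
    e * 1#               ≈⟨ *-congˡ be′≈1 ⟨
    e * (sum b * e′)     ≈⟨ solve 3 (λ e s f → e :* (s :* f) := s :* e :* f) refl e _ e′ ⟩
    sum b * e * e′       ≈⟨ *-congʳ be≈1 ⟩
    1# * e′              ≈⟨ *-identityˡ e′ ⟩
    e′                   ∎)

  -- The matrix with off-diagonal blocks `C` and `D`, extended by zero on the coordinates in `X`.
  bipartite : ∀ {p q} {X : Set} → Matrix p q → Matrix q p → Operator ((Fin p ⊎ Fin q) ⊎ X)
  bipartite C D v (inj₁ (inj₁ i)) = sum (λ j → C i j * v (inj₁ (inj₂ j)))
  bipartite C D v (inj₁ (inj₂ j)) = sum (λ i → D j i * v (inj₁ (inj₁ i)))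
  bipartite C D v (inj₂ _)        = 0#

  bipartite-cong : ∀ {p q} {X : Set} {C C′ : Matrix p q} {D D′ : Matrix q p} → C ≈ₘ C′ → D ≈ₘ D′ →
                   ∀ {u v} → u ≈ᵥ v → bipartite {X = X} C D u ≈ᵥ bipartite C′ D′ v
  bipartite-cong C≈ D≈ u≈v (inj₁ (inj₁ i)) = sum-cong-≋ λ j → *-cong (C≈ i j) (u≈v _)
  bipartite-cong C≈ D≈ u≈v (inj₁ (inj₂ j)) = sum-cong-≋ λ i → *-cong (D≈ j i) (u≈v _)
  bipartite-cong C≈ D≈ u≈v (inj₂ _)        = refl

  bipartite-reindex : ∀ {p q} {X Y : Set} (C : Matrix p q) (D : Matrix q p) → X ↔ Y →
                      OperatorSimilar (bipartite {X = X} C D) (bipartite {X = Y} C D)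
  bipartite-reindex C D φ = operatorSimilar-resp (λ u i → refl)
    (λ { v (inj₁ (inj₁ i)) → refl ; v (inj₁ (inj₂ j)) → refl ; v (inj₂ _) → refl })
    (operatorSimilar-reindex (↔-refl ⊎-↔ φ) (bipartite C D) (bipartite-cong (λ i j → refl) (λ i j → refl)))

  -- The vectors `a` and `b` are fields because they come from the scaling of a particular graph and
  -- are not determined at zero rows or columns of `B`; their products with the entries of `B` are.
  record Reduction {p q N} (B : Matrix p q) (L : Matrix N N) (r : ℕ) : Set (c ⊔ ℓ) where
    field
      a            : Vector Carrier p
      b            : Vector Carrier q
      a-normalises : ∀ i → Normalises (B i) (a i)
      b-normalises : ∀ j → Normalises (λ i → B i j) (b j)
      reduce       : OperatorSimilar (L ·ᵥ_)
                       (λ v x → v x - bipartite {X = Fin r} (λ i j → a i * B i j) (λ j i → b j * B i j) v x)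

  -- By `normalises-unique` both matrices reduce to the same operator, so one reduction can be
  -- composed with the inverse of the other.
  reductions⇒similar : ∀ {p q M N r s} {B : Matrix p q} {X : Matrix M M} {Y : Matrix N N} → r ≡ s →
                       Reduction B X r → Reduction B Y s → Similar X Y
  reductions⇒similar ≡.refl X-red Y-red = operatorSimilar⇒similar
    (operatorSimilar-trans Y.reduce (operatorSimilar-sym
      (λ u≈v x → +-cong (u≈v x) (-‿cong (bipartite-cong reflₘ reflₘ u≈v x)))
      (operatorSimilar-resp (λ u i → refl)
        (λ v x → +-congˡ (-‿cong (bipartite-cong
          (λ i → normalises-unique (X.a-normalises i) (Y.a-normalises i))
          (λ j → normalises-unique (X.b-normalises j) (Y.b-normalises j)) (reflᵥ {u = v}) x)))
        X.reduce)))
    where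
    module X = Reduction X-red
    module Y = Reduction Y-red

  -- There are `suc k` blocks of size `q` and `suc m` of size `p`, so each kind has a distinguished
  -- copy; `z` is the size of the zero padding.
  module BlockGraph (p q k m z : ℕ) where

    Index : Set
    Index = (Fin p ⊎ (Fin (suc k) × Fin q ⊎ Fin m × Fin p)) ⊎ Fin z

    pattern firstP i   = inj₁ (inj₁ i)
    pattern blockQ b j = inj₁ (inj₂ (inj₁ (b , j)))
    pattern restP a i  = inj₁ (inj₂ (inj₂ (a , i)))

    size : ℕ
    size = p ℕ.+ (suc k ℕ.* q ℕ.+ m ℕ.* p)

    index : Fin (size ℕ.+ z) ↔ Index
    index = ↔-trans Fin.+↔⊎ (↔-trans Fin.+↔⊎ (↔-refl ⊎-↔ ↔-trans Fin.+↔⊎ (Fin.*↔× {suc k} ⊎-↔ Fin.*↔×)) ⊎-↔ ↔-refl)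

    open Inverse index public using () renaming (to to decode; from to encode; strictlyInverseˡ to decode-encode)

    -- Forgets the copy and keeps the row or column of `B`; `nothing` marks padding. Adjacency
    -- depends on labels alone.
    label : Index → Maybe (Fin p ⊎ Fin q)
    label (firstP i)   = just (inj₁ i)
    label (blockQ b j) = just (inj₂ j)
    label (restP a i)  = just (inj₁ i)
    label (inj₂ w)     = nothing

    copiesP : (Index → Carrier) → Fin p → Vector Carrier (suc m)
    copiesP u i zero    = u (firstP i)
    copiesP u i (suc a) = u (restP a i)

    copiesQ : (Index → Carrier) → Fin q → Vector Carrier (suc k)
    copiesQ u j b = u (blockQ b j)

    copiesP-cong : ∀ {u v} → u ≈ᵥ v → ∀ i → copiesP u i ≈ᵥ copiesP v i
    copiesP-cong u≈v i zero    = u≈v _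
    copiesP-cong u≈v i (suc a) = u≈v _

    copiesP-linear : ∀ a u v i → copiesP (λ x → a * u x + v x) i ≈ᵥ λ b → a * copiesP u i b + copiesP v i b
    copiesP-linear a u v i zero    = refl
    copiesP-linear a u v i (suc b) = refl

    copiesP-const : ∀ x i → copiesP (λ _ → x) i ≈ᵥ λ _ → x
    copiesP-const x i zero    = refl
    copiesP-const x i (suc b) = refl

    -- Regroups the indices by label instead of position, so that the inner sums run over copies and
    -- can be read as means.
    sum-index : ∀ (f : Index → Carrier) → sum (f ∘ decode) ≈
                sum (λ i → sum (copiesP f i)) + sum (λ j → sum (copiesQ f j)) + sum (λ w → f (inj₂ w))
    sum-index f = begin
      sum g
        ≈⟨ sum-↑ size g ⟩
      sum (λ s → g (s ↑ˡ z)) + sum (λ w → g (size ↑ʳ w))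
        ≈⟨ +-congʳ (sum-↑ p (λ s → g (s ↑ˡ z))) ⟩
      sum (λ i → g (encode (firstP i))) + sum (λ t → g ((p ↑ʳ t) ↑ˡ z)) + sum (λ w → g (size ↑ʳ w))
        ≈⟨ +-congʳ (+-congˡ (trans (sum-↑ (suc k ℕ.* q) (λ t → g ((p ↑ʳ t) ↑ˡ z)))
             (+-cong (sum-combine (suc k) (λ t → g ((p ↑ʳ (t ↑ˡ (m ℕ.* p))) ↑ˡ z)))
                     (sum-combine m (λ t → g ((p ↑ʳ (suc k ℕ.* q ↑ʳ t)) ↑ˡ z)))))) ⟩
      sum (λ i → g (encode (firstP i))) +
        (sum (λ b → sum (λ j → g (encode (blockQ b j)))) + sum (λ a → sum (λ i → g (encode (restP a i))))) +
        sum (λ w → g (encode (inj₂ w)))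
        ≈⟨ +-cong (+-cong (sum-cong-≋ λ i → g∘encode (firstP i))
                          (+-cong (sum-cong-≋ λ b → sum-cong-≋ λ j → g∘encode (blockQ b j))
                                  (sum-cong-≋ λ a → sum-cong-≋ λ i → g∘encode (restP a i))))
                  (sum-cong-≋ λ w → g∘encode (inj₂ w)) ⟩
      sum (λ i → f (firstP i)) +
        (sum (λ b → sum (λ j → f (blockQ b j))) + sum (λ a → sum (λ i → f (restP a i)))) +
        sum (λ w → f (inj₂ w))
        ≈⟨ +-congʳ (+-congˡ (+-cong (∑-comm (λ b j → f (blockQ b j))) (∑-comm (λ a i → f (restP a i))))) ⟩
      sum (λ i → f (firstP i)) +
        (sum (λ j → sum (copiesQ f j)) + sum (λ i → sum (λ a → f (restP a i)))) +
        sum (λ w → f (inj₂ w))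
        ≈⟨ +-congʳ (solve 3 (λ x y z → x :+ (y :+ z) := x :+ z :+ y) refl _ _ _) ⟩
      sum (λ i → f (firstP i)) + sum (λ i → sum (λ a → f (restP a i))) + sum (λ j → sum (copiesQ f j)) +
        sum (λ w → f (inj₂ w))
        ≈⟨ +-congʳ (+-congʳ (∑-distrib-+ (λ i → f (firstP i)) (λ i → sum (λ a → f (restP a i))))) ⟨
      sum (λ i → sum (copiesP f i)) + sum (λ j → sum (copiesQ f j)) + sum (λ w → f (inj₂ w)) ∎
      where
      g : Vector Carrier (size ℕ.+ z)
      g = f ∘ decode
      g∘encode : ∀ x → g (encode x) ≈ f x
      g∘encode x = reflexive (≡.cong f (decode-encode x))

    module _ (B : Matrix p q) where

      entry : Maybe (Fin p ⊎ Fin q) → Maybe (Fin p ⊎ Fin q) → Carrier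
      entry (just (inj₁ i)) (just (inj₂ j)) = B i j
      entry (just (inj₂ j)) (just (inj₁ i)) = B i j
      entry _               _               = 0#

      adjacency : Index → Index → Carrier
      adjacency x y = entry (label x) (label y)

      sum-entryP : ∀ i u → sum (λ t → entry (just (inj₁ i)) (label (decode t)) * u (decode t)) ≈
                   sum (λ j → B i j * sum (copiesQ u j))
      sum-entryP i u = begin
        sum (f ∘ decode)
          ≈⟨ sum-index f ⟩
        sum (λ i → sum (copiesP f i)) + sum (λ j → sum (copiesQ f j)) + sum (λ w → f (inj₂ w))
          ≈⟨ +-cong (+-cong (sum-zero {p} λ i′ → sum-zero (copiesP≈0 i′))
                            (sum-cong-≋ λ j → sym (*-distribˡ-sum (B i j) (copiesQ u j))))
                    (sum-zero λ w → zeroˡ (u (inj₂ w))) ⟩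
        0# + sum (λ j → B i j * sum (copiesQ u j)) + 0#
          ≈⟨ trans (+-identityʳ _) (+-identityˡ _) ⟩
        sum (λ j → B i j * sum (copiesQ u j)) ∎
        where
        f : Index → Carrier
        f y = entry (just (inj₁ i)) (label y) * u y
        copiesP≈0 : ∀ i′ a → copiesP f i′ a ≈ 0#
        copiesP≈0 i′ zero    = zeroˡ _
        copiesP≈0 i′ (suc a) = zeroˡ _

      sum-entryQ : ∀ j u → sum (λ t → entry (just (inj₂ j)) (label (decode t)) * u (decode t)) ≈
                   sum (λ i → B i j * sum (copiesP u i))
      sum-entryQ j u = begin
        sum (f ∘ decode)
          ≈⟨ sum-index f ⟩
        sum (λ i → sum (copiesP f i)) + sum (λ j → sum (copiesQ f j)) + sum (λ w → f (inj₂ w))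
          ≈⟨ +-cong (+-cong (sum-cong-≋ λ i → trans (sum-cong-≋ (copiesP-entry i)) (sym (*-distribˡ-sum (B i j) (copiesP u i))))
                            (sum-zero λ j → sum-zero λ b → zeroˡ (u (blockQ b j))))
                    (sum-zero λ w → zeroˡ (u (inj₂ w))) ⟩
        sum (λ i → B i j * sum (copiesP u i)) + 0# + 0#
          ≈⟨ trans (+-identityʳ _) (+-identityʳ _) ⟩
        sum (λ i → B i j * sum (copiesP u i)) ∎
        where
        f : Index → Carrier
        f y = entry (just (inj₂ j)) (label y) * u y
        copiesP-entry : ∀ i → copiesP f i ≈ᵥ λ a → B i j * copiesP u i a
        copiesP-entry i zero    = refl
        copiesP-entry i (suc a) = refl

      module _ (e : Index → Carrier) (e-normalises : ∀ x → Normalises (λ t → adjacency x (decode t)) (e x)) where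

        -- A vertex labelled by row `i` meets `suc k` copies of each column, so its row sum is
        -- `card (suc k)` times that of `B i`; the factor moves over to `e x`.
        normalisesP : ∀ x {i} → label x ≡ just (inj₁ i) → Normalises (B i) (card (suc k) * e x)
        normalisesP x {i} label≡ with label x | e-normalises x
        -- Every entry of `B i` occurs in the row of `x`, for instance in copy `zero` of the
        -- size-`q` blocks.
        normalisesP x {i} ≡.refl | _ | inj₁ row≈0 = inj₁ λ j → begin
          B i j                                                                  ≡⟨⟩
          entry (just (inj₁ i)) (label (blockQ zero j))                          ≡⟨ ≡.cong (entry (just (inj₁ i)) ∘ label) (decode-encode (blockQ zero j)) ⟨
          entry (just (inj₁ i)) (label (decode (encode (blockQ zero j))))        ≈⟨ row≈0 (encode (blockQ zero j)) ⟩
          0#                                                                     ∎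
        normalisesP x {i} ≡.refl | _ | inj₂ sum*e≈1 = inj₂ (begin
          sum (B i) * (card (suc k) * e x)
            ≈⟨ *-assoc _ _ _ ⟨
          sum (B i) * card (suc k) * e x
            ≈⟨ *-congʳ (*-distribʳ-sum (card (suc k)) (B i)) ⟩
          sum (λ j → B i j * card (suc k)) * e x
            ≈⟨ *-congʳ (sum-entryP i (λ _ → 1#)) ⟨
          sum (λ t → entry (just (inj₁ i)) (label (decode t)) * 1#) * e x
            ≈⟨ *-congʳ (sum-cong-≋ λ t → *-identityʳ (entry (just (inj₁ i)) (label (decode t)))) ⟩
          sum (λ t → entry (just (inj₁ i)) (label (decode t))) * e x
            ≈⟨ sum*e≈1 ⟩
          1# ∎)

        normalisesQ : ∀ x {j} → label x ≡ just (inj₂ j) → Normalises (λ i → B i j) (card (suc m) * e x)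
        normalisesQ x {j} label≡ with label x | e-normalises x
        normalisesQ x {j} ≡.refl | _ | inj₁ row≈0 = inj₁ λ i → begin
          B i j                                                            ≡⟨⟩
          entry (just (inj₂ j)) (label (firstP i))                         ≡⟨ ≡.cong (entry (just (inj₂ j)) ∘ label) (decode-encode (firstP i)) ⟨
          entry (just (inj₂ j)) (label (decode (encode (firstP i))))       ≈⟨ row≈0 (encode (firstP i)) ⟩
          0#                                                               ∎
        normalisesQ x {j} ≡.refl | _ | inj₂ sum*e≈1 = inj₂ (begin
          sum (λ i → B i j) * (card (suc m) * e x)
            ≈⟨ *-assoc _ _ _ ⟨
          sum (λ i → B i j) * card (suc m) * e x
            ≈⟨ *-congʳ (*-distribʳ-sum (card (suc m)) (λ i → B i j)) ⟩
          sum (λ i → B i j * card (suc m)) * e x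
            ≈⟨ *-congʳ (sum-cong-≋ λ i → *-congˡ {x = B i j} (sum-cong-≋ (copiesP-const 1# i))) ⟨
          sum (λ i → B i j * sum (copiesP (λ _ → 1#) i)) * e x
            ≈⟨ *-congʳ (sum-entryQ j (λ _ → 1#)) ⟨
          sum (λ t → entry (just (inj₂ j)) (label (decode t)) * 1#) * e x
            ≈⟨ *-congʳ (sum-cong-≋ λ t → *-identityʳ (entry (just (inj₂ j)) (label (decode t)))) ⟩
          sum (λ t → entry (just (inj₂ j)) (label (decode t))) * e x
            ≈⟨ sum*e≈1 ⟩
          1# ∎)

        -- The matrix with rows divided by their sums, that is, the transition operator of the
        -- random walk; on a zero row `e` is arbitrary.
        walk : Operator Index
        walk u x = e x * sum (λ t → adjacency x (decode t) * u (decode t))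

        -- `B` with rows divided by their sums. The copy at which `e` is read is only a
        -- representative: `normalises-unique` makes the product the same at every copy.
        stepP : Matrix p q
        stepP i j = card (suc k) * e (firstP i) * B i j

        stepQ : Matrix q p
        stepQ j i = card (suc m) * e (blockQ zero j) * B i j

        -- Coordinates for the deviations, with one copy of each label left out, and for the
        -- padding.
        Rest : Set
        Rest = (Fin m × Fin p ⊎ Fin k × Fin q) ⊎ Fin z

        module _ {h h′ : Carrier} (h*k≈1 : h * card (suc k) ≈ 1#) (h′*m≈1 : h′ * card (suc m) ≈ 1#) where

          private
            module Q = Mean {k} {h} h*k≈1
            module P = Mean {m} {h′} h′*m≈1

          -- Inserting `h * n`, which is 1, lets the number `n` of copies complete the normalising
          -- factor while `h` turns the sum `s` into a mean.
          step-mean : ∀ {c h n e b} s → h * n ≈ 1# → n * e * b ≈ c → e * (b * s) ≈ c * (h * s)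
          step-mean {c} {h} {n} {e} {b} s hn≈1 neb≈c = begin
            e * (b * s)                ≈⟨ *-identityˡ _ ⟨
            1# * (e * (b * s))         ≈⟨ *-congʳ hn≈1 ⟨
            h * n * (e * (b * s))      ≈⟨ solve 5 (λ h n e b s → h :* n :* (e :* (b :* s)) := n :* e :* b :* (h :* s)) refl h n e b s ⟩
            n * e * b * (h * s)        ≈⟨ *-congʳ neb≈c ⟩
            c * (h * s)                ∎

          means : (Index → Carrier) → Fin p ⊎ Fin q → Carrier
          means u (inj₁ i) = P.mean (copiesP u i)
          means u (inj₂ j) = Q.mean (copiesQ u j)

          -- The right side does not mention `x`: although `e x` may vary between copies of a zero
          -- row, `e x * B i j` does not. So `walk u` is constant along copies and sees only means.
          walkP : ∀ u x {i} → label x ≡ just (inj₁ i) → walk u x ≈ sum (λ j → stepP i j * means u (inj₂ j))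
          walkP u x {i} label≡ with label x in eq
          walkP u x {i} ≡.refl | _ = begin
            e x * sum (λ t → entry (just (inj₁ i)) (label (decode t)) * u (decode t))
              ≈⟨ *-congˡ (sum-entryP i u) ⟩
            e x * sum (λ j → B i j * sum (copiesQ u j))
              ≈⟨ *-distribˡ-sum (e x) (λ j → B i j * sum (copiesQ u j)) ⟩
            sum (λ j → e x * (B i j * sum (copiesQ u j)))
              ≈⟨ sum-cong-≋ (λ j → step-mean (sum (copiesQ u j)) h*k≈1
                   (normalises-unique (normalisesP x eq) (normalisesP (firstP i) ≡.refl) j)) ⟩
            sum (λ j → stepP i j * Q.mean (copiesQ u j)) ∎

          walkQ : ∀ u x {j} → label x ≡ just (inj₂ j) → walk u x ≈ sum (λ i → stepQ j i * means u (inj₁ i))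
          walkQ u x {j} label≡ with label x in eq
          walkQ u x {j} ≡.refl | _ = begin
            e x * sum (λ t → entry (just (inj₂ j)) (label (decode t)) * u (decode t))
              ≈⟨ *-congˡ (sum-entryQ j u) ⟩
            e x * sum (λ i → B i j * sum (copiesP u i))
              ≈⟨ *-distribˡ-sum (e x) (λ i → B i j * sum (copiesP u i)) ⟩
            sum (λ i → e x * (B i j * sum (copiesP u i)))
              ≈⟨ sum-cong-≋ (λ i → step-mean (sum (copiesP u i)) h′*m≈1
                   (normalises-unique (normalisesQ x eq) (normalisesQ (blockQ zero j) ≡.refl) i)) ⟩
            sum (λ i → stepQ j i * P.mean (copiesP u i)) ∎

          walk-pad : ∀ u w → walk u (inj₂ w) ≈ 0#
          walk-pad u w = trans (*-congˡ (sum-zero λ t → zeroˡ (u (decode t)))) (zeroʳ _)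

          -- The means of the copies, and the deviations from them of all
          -- copies but one.
          walk-similar : OperatorSimilar walk (bipartite {X = Rest} stepP stepQ)
          walk-similar = record
            { to = to ; from = from
            ; to-isLinear   = record { cong = to-cong ; linear = to-linear }
            ; from-isLinear = record { cong = from-cong ; linear = from-linear }
            ; from-to = from-to ; to-from = to-from ; to-intertwine = intertwine
            }
            where
            to : (Index → Carrier) → (Fin p ⊎ Fin q) ⊎ Rest → Carrier
            to u (inj₁ y)                      = means u y
            to u (inj₂ (inj₁ (inj₁ (a , i)))) = u (restP a i) - means u (inj₁ i)
            to u (inj₂ (inj₁ (inj₂ (b , j)))) = u (blockQ (suc b) j) - means u (inj₂ j)
            to u (inj₂ (inj₂ w))              = u (inj₂ w)

            deviationsP : ((Fin p ⊎ Fin q) ⊎ Rest → Carrier) → Fin p → Vector Carrier m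
            deviationsP v i a = v (inj₂ (inj₁ (inj₁ (a , i))))

            deviationsQ : ((Fin p ⊎ Fin q) ⊎ Rest → Carrier) → Fin q → Vector Carrier k
            deviationsQ v j b = v (inj₂ (inj₁ (inj₂ (b , j))))

            from : ((Fin p ⊎ Fin q) ⊎ Rest → Carrier) → Index → Carrier
            from v (firstP i)   = P.restore (v (inj₁ (inj₁ i))) (deviationsP v i) zero
            from v (restP a i)  = P.restore (v (inj₁ (inj₁ i))) (deviationsP v i) (suc a)
            from v (blockQ b j) = Q.restore (v (inj₁ (inj₂ j))) (deviationsQ v j) b
            from v (inj₂ w)     = v (inj₂ (inj₂ w))

            means-cong : ∀ {u v} → u ≈ᵥ v → means u ≈ᵥ means v
            means-cong u≈v (inj₁ i) = P.mean-cong (copiesP-cong u≈v i)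
            means-cong u≈v (inj₂ j) = Q.mean-cong (λ b → u≈v (blockQ b j))

            means-linear : ∀ a u v → means (λ x → a * u x + v x) ≈ᵥ λ y → a * means u y + means v y
            means-linear a u v (inj₁ i) = trans (P.mean-cong (copiesP-linear a u v i)) (P.mean-linear a (copiesP u i) (copiesP v i))
            means-linear a u v (inj₂ j) = Q.mean-linear a (copiesQ u j) (copiesQ v j)

            -‿linear : ∀ a x y x′ y′ → (a * x + y) - (a * x′ + y′) ≈ a * (x - x′) + (y - y′)
            -‿linear a x y x′ y′ = begin
              a * x + y - (a * x′ + y′)             ≈⟨ +-congˡ (-1*x≈-x _) ⟨
              a * x + y + - 1# * (a * x′ + y′)      ≈⟨ solve 6 (λ a x y x′ y′ s → a :* x :+ y :+ s :* (a :* x′ :+ y′) := a :* (x :+ s :* x′) :+ (y :+ s :* y′)) refl a x y x′ y′ (- 1#) ⟩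
              a * (x + - 1# * x′) + (y + - 1# * y′) ≈⟨ +-cong (*-congˡ (+-congˡ (-1*x≈-x x′))) (+-congˡ (-1*x≈-x y′)) ⟩
              a * (x - x′) + (y - y′)               ∎

            +-linear : ∀ a x y x′ y′ → (a * x + y) + (a * x′ + y′) ≈ a * (x + x′) + (y + y′)
            +-linear = solve 5 (λ a x y x′ y′ → (a :* x :+ y) :+ (a :* x′ :+ y′) := a :* (x :+ x′) :+ (y :+ y′)) refl

            sum-linear : ∀ {n} a (u v : Vector Carrier n) → sum (λ i → a * u i + v i) ≈ a * sum u + sum v
            sum-linear a u v = trans (∑-distrib-+ (λ i → a * u i) v) (+-congʳ (sym (*-distribˡ-sum a u)))

            to-cong : ∀ {u v} → u ≈ᵥ v → to u ≈ᵥ to v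
            to-cong u≈v (inj₁ y)                      = means-cong u≈v y
            to-cong u≈v (inj₂ (inj₁ (inj₁ (a , i)))) = +-cong (u≈v _) (-‿cong (means-cong u≈v (inj₁ i)))
            to-cong u≈v (inj₂ (inj₁ (inj₂ (b , j)))) = +-cong (u≈v _) (-‿cong (means-cong u≈v (inj₂ j)))
            to-cong u≈v (inj₂ (inj₂ w))              = u≈v _

            to-linear : ∀ a u v → to (λ x → a * u x + v x) ≈ᵥ λ y → a * to u y + to v y
            to-linear a u v (inj₁ y)                      = means-linear a u v y
            to-linear a u v (inj₂ (inj₁ (inj₁ (b , i)))) = trans (+-congˡ (-‿cong (means-linear a u v (inj₁ i)))) (-‿linear a _ _ _ _)
            to-linear a u v (inj₂ (inj₁ (inj₂ (b , j)))) = trans (+-congˡ (-‿cong (means-linear a u v (inj₂ j)))) (-‿linear a _ _ _ _)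
            to-linear a u v (inj₂ (inj₂ w))              = refl

            from-cong : ∀ {u v} → u ≈ᵥ v → from u ≈ᵥ from v
            from-cong u≈v (firstP i)         = +-cong (u≈v _) (-‿cong (sum-cong-≋ λ a → u≈v (inj₂ (inj₁ (inj₁ (a , i))))))
            from-cong u≈v (restP a i)        = +-cong (u≈v _) (u≈v _)
            from-cong u≈v (blockQ zero j)    = +-cong (u≈v _) (-‿cong (sum-cong-≋ λ b → u≈v (inj₂ (inj₁ (inj₂ (b , j))))))
            from-cong u≈v (blockQ (suc b) j) = +-cong (u≈v _) (u≈v _)
            from-cong u≈v (inj₂ w)           = u≈v _

            from-linear : ∀ a u v → from (λ x → a * u x + v x) ≈ᵥ λ y → a * from u y + from v y
            from-linear a u v (firstP i)         = trans (+-congˡ (-‿cong (sum-linear a (deviationsP u i) (deviationsP v i)))) (-‿linear a _ _ _ _)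
            from-linear a u v (restP b i)        = +-linear a _ _ _ _
            from-linear a u v (blockQ zero j)    = trans (+-congˡ (-‿cong (sum-linear a (deviationsQ u j) (deviationsQ v j)))) (-‿linear a _ _ _ _)
            from-linear a u v (blockQ (suc b) j) = +-linear a _ _ _ _
            from-linear a u v (inj₂ w)           = refl

            from-to : ∀ u → from (to u) ≈ᵥ u
            from-to u (firstP i)         = P.restore-mean (copiesP u i) zero
            from-to u (restP a i)        = P.restore-mean (copiesP u i) (suc a)
            from-to u (blockQ zero j)    = Q.restore-mean (copiesQ u j) zero
            from-to u (blockQ (suc b) j) = Q.restore-mean (copiesQ u j) (suc b)
            from-to u (inj₂ w)           = refl

            copiesP-from : ∀ v i → copiesP (from v) i ≈ᵥ P.restore (v (inj₁ (inj₁ i))) (deviationsP v i)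
            copiesP-from v i zero    = refl
            copiesP-from v i (suc a) = refl

            means-from : ∀ v y → means (from v) y ≈ v (inj₁ y)
            means-from v (inj₁ i) = trans (P.mean-cong (copiesP-from v i)) (P.mean-restore (v (inj₁ (inj₁ i))) (deviationsP v i))
            means-from v (inj₂ j) = Q.mean-restore (v (inj₁ (inj₂ j))) (deviationsQ v j)

            cancel : ∀ {x y z} → x ≈ y → y + z - x ≈ z
            cancel {x} {y} {z} x≈y = begin
              y + z - x  ≈⟨ +-cong (+-comm y z) (-‿cong x≈y) ⟩
              z + y - y  ≈⟨ //-rightDividesʳ y z ⟩
              z          ∎

            to-from : ∀ v → to (from v) ≈ᵥ v
            to-from v (inj₁ y)                      = means-from v y
            to-from v (inj₂ (inj₁ (inj₁ (a , i)))) = cancel (means-from v (inj₁ i))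
            to-from v (inj₂ (inj₁ (inj₂ (b , j)))) = cancel (means-from v (inj₂ j))
            to-from v (inj₂ (inj₂ w))              = refl

            copiesP-walk : ∀ u i → copiesP (walk u) i ≈ᵥ λ _ → sum (λ j → stepP i j * means u (inj₂ j))
            copiesP-walk u i zero    = walkP u (firstP i) ≡.refl
            copiesP-walk u i (suc a) = walkP u (restP a i) ≡.refl

            means-walk : ∀ u y → means (walk u) y ≈ bipartite {X = Rest} stepP stepQ (to u) (inj₁ y)
            means-walk u (inj₁ i) = trans (P.mean-cong (copiesP-walk u i)) (P.mean-const _)
            means-walk u (inj₂ j) = trans (Q.mean-cong (λ b → walkQ u (blockQ b j) ≡.refl)) (Q.mean-const _)

            intertwine : ∀ u → to (walk u) ≈ᵥ bipartite stepP stepQ (to u)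
            intertwine u (inj₁ y@(inj₁ i)) = means-walk u y
            intertwine u (inj₁ y@(inj₂ j)) = means-walk u y
            -- As `walk u` is constant along copies, it equals its mean there and all deviations
            -- vanish.
            intertwine u (inj₂ (inj₁ (inj₁ (a , i)))) = x≈y⇒x∙y⁻¹≈ε (trans (walkP u (restP a i) ≡.refl) (sym (means-walk u (inj₁ i))))
            intertwine u (inj₂ (inj₁ (inj₂ (b , j)))) = x≈y⇒x∙y⁻¹≈ε (trans (walkQ u (blockQ (suc b) j) ≡.refl) (sym (means-walk u (inj₂ j))))
            intertwine u (inj₂ (inj₂ w)) = walk-pad u w

      -- Similarity preserves the identity, so only `D M D` has to be reduced. From
      -- `D (D M D) = (D² M) D` it is conjugate to `D² M`, which is `walk` after reindexing because
      -- `d²` normalises every row of `M`.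
      laplacian-reduction : (M L : Matrix (size ℕ.+ z) (size ℕ.+ z)) → (∀ s t → M s t ≈ adjacency (decode s) (decode t)) →
        (d d⁻¹ : Vector Carrier (size ℕ.+ z)) → (∀ s → d s * d⁻¹ s ≈ 1#) →
        (∀ s → Normalises (M s) (d s * d s)) →
        L ≈ₘ (λ s t → Iₘ _ s t - d s * M s t * d t) →
        (h h′ : Carrier) → h * card (suc k) ≈ 1# → h′ * card (suc m) ≈ 1# →
        Reduction B L ((m ℕ.* p ℕ.+ k ℕ.* q) ℕ.+ z)
      laplacian-reduction M L M≈adj d d⁻¹ dd⁻¹≈1 norm L≈ h h′ h*k≈1 h′*m≈1 =
        record
          { a = λ i → card (suc k) * e (firstP i)
          ; b = λ j → card (suc m) * e (blockQ zero j)
          ; a-normalises = λ i → normalisesP e e-norm (firstP i) ≡.refl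
          ; b-normalises = λ j → normalisesQ e e-norm (blockQ zero j) ≡.refl
          ; reduce = operatorSimilar-resp (λ u s → sym (L≈id- u s)) (λ v x → refl)
              (operatorSimilar-id-
                (operatorSimilar-trans (operatorSimilar-scale d d⁻¹ dd⁻¹≈1 scale)
                  (operatorSimilar-trans
                    (operatorSimilar-resp (λ u s → refl) reindexed (operatorSimilar-reindex index W W-cong))
                    (operatorSimilar-trans (walk-similar e e-norm h*k≈1 h′*m≈1)
                      (bipartite-reindex _ _ rest)))))
          }
        where
        e : Index → Carrier
        e x = d (encode x) * d (encode x)

        adj≈M : ∀ x t → adjacency x (decode t) ≈ M (encode x) t
        adj≈M x t = sym (trans (M≈adj (encode x) t) (reflexive (≡.cong (λ y → adjacency y (decode t)) (decode-encode x))))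

        e-norm : ∀ x → Normalises (λ t → adjacency x (decode t)) (e x)
        e-norm x with norm (encode x)
        ... | inj₁ row≈0   = inj₁ λ t → trans (adj≈M x t) (row≈0 t)
        ... | inj₂ sum*e≈1 = inj₂ (trans (*-congʳ (sum-cong-≋ (adj≈M x))) sum*e≈1)

        W : Operator (Fin (size ℕ.+ z))
        W u s = d s * d s * sum (λ t → M s t * u t)

        W-cong : ∀ {u v} → u ≈ᵥ v → W u ≈ᵥ W v
        W-cong u≈v s = *-congˡ (sum-cong-≋ λ t → *-congˡ (u≈v t))

        reindexed : ∀ v x → W (v ∘ decode) (encode x) ≈ walk e e-norm v x
        reindexed v x = *-congˡ (sum-cong-≋ λ t → *-congʳ (sym (adj≈M x t)))

        DMD : Operator (Fin (size ℕ.+ z))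
        DMD u s = sum (λ t → d s * M s t * d t * u t)

        scale : ∀ u s → d s * DMD u s ≈ W (λ t → d t * u t) s
        scale u s = begin
          d s * sum (λ t → d s * M s t * d t * u t)
            ≈⟨ *-congˡ (sum-cong-≋ λ t → solve 4 (λ d m e u → d :* m :* e :* u := d :* (m :* (e :* u))) refl (d s) (M s t) (d t) (u t)) ⟩
          d s * sum (λ t → d s * (M s t * (d t * u t)))
            ≈⟨ *-congˡ (*-distribˡ-sum (d s) (λ t → M s t * (d t * u t))) ⟨
          d s * (d s * sum (λ t → M s t * (d t * u t)))
            ≈⟨ *-assoc _ _ _ ⟨
          d s * d s * sum (λ t → M s t * (d t * u t)) ∎

        L≈id- : ∀ u s → (L ·ᵥ u) s ≈ u s - DMD u s
        L≈id- u s = begin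
          sum (λ t → L s t * u t)
            ≈⟨ sum-cong-≋ (λ t → trans (*-congʳ (L≈ s t)) ([y-z]x≈yx-zx (u t) (Iₘ _ s t) (d s * M s t * d t))) ⟩
          sum (λ t → Iₘ _ s t * u t - d s * M s t * d t * u t)
            ≈⟨ sum-- (λ t → Iₘ _ s t * u t) (λ t → d s * M s t * d t * u t) ⟩
          sum (λ t → Iₘ _ s t * u t) - DMD u s
            ≈⟨ +-congʳ (sum-I* s u) ⟩
          u s - DMD u s ∎

        rest : ((Fin m × Fin p ⊎ Fin k × Fin q) ⊎ Fin z) ↔ Fin ((m ℕ.* p ℕ.+ k ℕ.* q) ℕ.+ z)
        rest = ↔-sym (↔-trans Fin.+↔⊎ (↔-trans Fin.+↔⊎ (Fin.*↔× ⊎-↔ Fin.*↔×) ⊎-↔ ↔-refl))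

  -- Extending a normalized Laplacian by a zero block.

  ⊕-↑ˡ↑ˡ : ∀ {m n} (X : Matrix m m) (Y : Matrix n n) i j → (X ⊕ Y) (i ↑ˡ n) (j ↑ˡ n) ≡ X i j
  ⊕-↑ˡ↑ˡ {m} {n} X Y i j rewrite Fin.splitAt-↑ˡ m i n | Fin.splitAt-↑ˡ m j n = ≡.refl

  ⊕-↑ˡ↑ʳ : ∀ {m n} (X : Matrix m m) (Y : Matrix n n) i j → (X ⊕ Y) (i ↑ˡ n) (m ↑ʳ j) ≡ 0#
  ⊕-↑ˡ↑ʳ {m} {n} X Y i j rewrite Fin.splitAt-↑ˡ m i n | Fin.splitAt-↑ʳ m n j = ≡.refl

  ⊕-↑ʳ↑ˡ : ∀ {m n} (X : Matrix m m) (Y : Matrix n n) i j → (X ⊕ Y) (m ↑ʳ i) (j ↑ˡ n) ≡ 0#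
  ⊕-↑ʳ↑ˡ {m} {n} X Y i j rewrite Fin.splitAt-↑ʳ m n i | Fin.splitAt-↑ˡ m j n = ≡.refl

  ⊕-↑ʳ↑ʳ : ∀ {m n} (X : Matrix m m) (Y : Matrix n n) i j → (X ⊕ Y) (m ↑ʳ i) (m ↑ʳ j) ≡ Y i j
  ⊕-↑ʳ↑ʳ {m} {n} X Y i j rewrite Fin.splitAt-↑ʳ m n i | Fin.splitAt-↑ʳ m n j = ≡.refl

  ↑-elim : ∀ m {n a} (P : Fin (m ℕ.+ n) → Set a) → (∀ i → P (i ↑ˡ n)) → (∀ j → P (m ↑ʳ j)) → ∀ s → P s
  ↑-elim m {n} P left right s with splitAt m s | Fin.join-splitAt m n s
  ... | inj₁ i | ≡.refl = left i
  ... | inj₂ j | ≡.refl = right j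

  module _ {r k : ℕ} where

    -- The value 1 on the zero block is a default. Rows and columns of `M₁ ⊕ 0ₘ k` vanish there, so
    -- `I - D M D` has the prescribed identity block, and `D` stays invertible.
    extend : Vector Carrier r → Vector Carrier (r ℕ.+ k)
    extend d = [ d , (λ _ → 1#) ]′ ∘ splitAt r

    extend-↑ˡ : ∀ d i → extend d (i ↑ˡ k) ≡ d i
    extend-↑ˡ d i = ≡.cong [ d , (λ _ → 1#) ]′ (Fin.splitAt-↑ˡ r i k)

    extend-inverse : ∀ {d d⁻¹} → (∀ i → d i * d⁻¹ i ≈ 1#) → ∀ s → extend d s * extend d⁻¹ s ≈ 1#
    extend-inverse dd⁻¹≈1 s with splitAt r s
    ... | inj₁ i = dd⁻¹≈1 i
    ... | inj₂ _ = *-identityʳ 1#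

    module _ {M₁ L₁ : Matrix r r} {d : Vector Carrier r} where

      extend-normalises : (∀ i → sum (M₁ i) * (d i * d i) ≈ 1#) →
                          ∀ s → Normalises ((M₁ ⊕ 0ₘ k) s) (extend d s * extend d s)
      extend-normalises norm = ↑-elim r _
        (λ i → inj₂ (begin
          sum ((M₁ ⊕ 0ₘ k) (i ↑ˡ k)) * (extend d (i ↑ˡ k) * extend d (i ↑ˡ k))
            ≡⟨ ≡.cong (λ x → sum ((M₁ ⊕ 0ₘ k) (i ↑ˡ k)) * (x * x)) (extend-↑ˡ d i) ⟩
          sum ((M₁ ⊕ 0ₘ k) (i ↑ˡ k)) * (d i * d i)
            ≈⟨ *-congʳ (sum-↑ r ((M₁ ⊕ 0ₘ k) (i ↑ˡ k))) ⟩
          (sum (λ j → (M₁ ⊕ 0ₘ k) (i ↑ˡ k) (j ↑ˡ k)) + sum (λ j → (M₁ ⊕ 0ₘ k) (i ↑ˡ k) (r ↑ʳ j))) * (d i * d i)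
            ≈⟨ *-congʳ (+-cong (sum-cong-≋ λ j → reflexive (⊕-↑ˡ↑ˡ M₁ (0ₘ k) i j)) (sum-zero λ j → reflexive (⊕-↑ˡ↑ʳ M₁ (0ₘ k) i j))) ⟩
          (sum (M₁ i) + 0#) * (d i * d i)
            ≈⟨ *-congʳ (+-identityʳ _) ⟩
          sum (M₁ i) * (d i * d i)
            ≈⟨ norm i ⟩
          1# ∎))
        (λ i → inj₁ (↑-elim r _ (λ j → reflexive (⊕-↑ʳ↑ˡ M₁ (0ₘ k) i j)) (λ j → reflexive (⊕-↑ʳ↑ʳ M₁ (0ₘ k) i j))))

      extend-laplacian : L₁ ≈ₘ (λ i j → Iₘ r i j - d i * M₁ i j * d j) →
                         L₁ ⊕ Iₘ k ≈ₘ λ s t → Iₘ (r ℕ.+ k) s t - extend d s * (M₁ ⊕ 0ₘ k) s t * extend d t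
      extend-laplacian L₁≈ = ↑-elim r _
        (λ i → ↑-elim r _
          (λ j → begin
            (L₁ ⊕ Iₘ k) (i ↑ˡ k) (j ↑ˡ k)   ≡⟨ ⊕-↑ˡ↑ˡ L₁ (Iₘ k) i j ⟩
            L₁ i j                          ≈⟨ L₁≈ i j ⟩
            Iₘ r i j - d i * M₁ i j * d j   ≈⟨ +-cong (I-injective (_↑ˡ k) (Fin.↑ˡ-injective k _ _) i j)
                                                 (-‿cong (*-cong (*-cong (reflexive (extend-↑ˡ d i)) (reflexive (⊕-↑ˡ↑ˡ M₁ (0ₘ k) i j))) (reflexive (extend-↑ˡ d j)))) ⟨
            _ ∎)
          (λ j → off (⊕-↑ˡ↑ʳ L₁ (Iₘ k) i j) (I-off-diag (↑ˡ≢↑ʳ i j)) (⊕-↑ˡ↑ʳ M₁ (0ₘ k) i j)))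
        (λ i → ↑-elim r _
          (λ j → off (⊕-↑ʳ↑ˡ L₁ (Iₘ k) i j) (I-off-diag (↑ˡ≢↑ʳ j i ∘ ≡.sym)) (⊕-↑ʳ↑ˡ M₁ (0ₘ k) i j))
          (λ j → off (⊕-↑ʳ↑ʳ L₁ (Iₘ k) i j) (I-injective (r ↑ʳ_) (Fin.↑ʳ-injective r _ _) i j) (⊕-↑ʳ↑ʳ M₁ (0ₘ k) i j)))
        where
        ↑ˡ≢↑ʳ : ∀ (i : Fin r) (j : Fin k) → i ↑ˡ k ≢ r ↑ʳ j
        ↑ˡ≢↑ʳ i j eq with ≡.trans (≡.sym (Fin.splitAt-↑ˡ r i k)) (≡.trans (≡.cong (splitAt r) eq) (Fin.splitAt-↑ʳ r k j))
        ... | ()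

        off : ∀ {l x y m a b} → l ≡ x → y ≈ x → m ≡ 0# → l ≈ y - a * m * b
        off {x = x} {y} {a = a} {b} ≡.refl y≈x ≡.refl = sym (begin
          y - a * 0# * b  ≈⟨ +-cong y≈x (-‿cong (trans (*-congʳ (zeroʳ a)) (zeroˡ b))) ⟩
          x - 0#          ≈⟨ +-congˡ -0#≈0# ⟩
          x + 0#          ≈⟨ +-identityʳ x ⟩
          x               ∎)

-- Passage from real to complex similarity.

module ComplexSimilarity {c ℓ} (R : CommutativeRing c ℓ) where

  private
    module R = CommutativeRing R
    module C = CommutativeRing (complexRing R)
    module MR = Matrices R
    module MC = Matrices (complexRing R)
    module DR = LinearAlgebra R
    module DC = LinearAlgebra (complexRing R)

  open RingProperties R.ring using (-0#≈0#)

  ι : R.Carrier → C.Carrier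
  ι x = x , R.0#

  ιₘ : ∀ {m n} → MR.Matrix m n → MC.Matrix m n
  ιₘ X i j = ι (X i j)

  ι-sum : ∀ {n} (f g : Vector R.Carrier n) → MC.sum (λ i → ι (f i) C.* ι (g i)) C.≈ ι (MR.sum (λ i → f i R.* g i))
  ι-sum {zero}  f g = C.refl
  ι-sum {suc n} f g = C.trans (C.+-cong (ι-* (f zero) (g zero)) (ι-sum (f ∘ suc) (g ∘ suc))) (R.refl , R.+-identityʳ R.0#)
    where
    ι-* : ∀ x y → ι x C.* ι y C.≈ ι (x R.* y)
    ι-* x y = R.trans (R.+-congˡ (R.trans (R.-‿cong (R.zeroˡ R.0#)) -0#≈0#)) (R.+-identityʳ _) ,
              R.trans (R.+-cong (R.zeroʳ x) (R.zeroˡ y)) (R.+-identityʳ _)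

  ι-I : ∀ {n} (i j : Fin n) → ι (MR.Iₘ n i j) C.≈ MC.Iₘ n i j
  ι-I i j with i Fin.≟ j
  ... | yes _ = C.refl
  ... | no _  = C.refl

  similar-complex : ∀ {m n} {X : MR.Matrix m m} {Y : MR.Matrix n n} → DR.Similar X Y → DC.Similar (ιₘ X) (ιₘ Y)
  similar-complex {X = X} {Y} X~Y = record
    { P = ιₘ P ; Q = ιₘ Q
    ; P·Q≈I = λ i k → C.trans (ι-sum (P i) (λ j → Q j k)) (C.trans (P·Q≈I i k , R.refl) (ι-I i k))
    ; Q·P≈I = λ i k → C.trans (ι-sum (Q i) (λ j → P j k)) (C.trans (Q·P≈I i k , R.refl) (ι-I i k))
    ; intertwine = λ i k → C.trans (ι-sum (X i) (λ j → P j k)) (C.trans (intertwine i k , R.refl) (C.sym (ι-sum (P i) (λ j → Y j k))))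
    }
    where open DR.Similar X~Y

-- Spectra, positivity, and the scaling contained in a normalized Laplacian.

module RealSpectra {c ℓ₁ ℓ₂} (ℝ : RealField c ℓ₁ ℓ₂) where

  open RealField ℝ hiding (zero)
  open RealMatrices ℝ
  open Matrices commutativeRing using (sum)
  open LinearAlgebra commutativeRing
  open Blocks commutativeRing
  open ComplexSimilarity commutativeRing
  open RingProperties (CommutativeRing.ring commutativeRing) using (-0#≈0#; -1*x≈-x; -‿involutive)
  open SemiringSum (CommutativeRing.semiring commutativeRing) using (sum-cong-≋; sum-permute)
  open SetoidReasoning setoid
  private
    module < = IsStrictPartialOrder isStrictPartialOrder
    module DC = LinearAlgebra complexField

  similar⇒cospectral : ∀ {m n} {X : Matrix m m} {Y : Matrix n n} → m ≡ n → Similar X Y → Cospectral X Y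
  -- Identifying the sizes makes `P` and `Q` square, as multiplicativity of `det` requires. The
  -- characteristic polynomials then agree as functions, and the same cofactor `g` serves both
  -- matrices.
  similar⇒cospectral ≡.refl X~Y μ r = mk⇔ (transfer (similar-sym X~Y)) (transfer X~Y)
    where
    transfer : ∀ {n} {X Y : Matrix n n} → Similar X Y → HasEigenvalueOfMultiplicity Y μ r → HasEigenvalueOfMultiplicity X μ r
    transfer X~Y (eigen , g , charPoly≈ , g≉0) =
      DC.similar-isEigenvalue (similar-complex X~Y) eigen , g ,
      (λ x → CommutativeRing.trans complexField (DC.similar-charPoly (similar-complex X~Y) x) (charPoly≈ x)) , g≉0

  -- 1 is invertible, hence apart from 0. If it were negative, then -1 would be positive, and so
  -- would its square, which is 1.
  0<1 : 0# < 1#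
  0<1 with #⇒<⊎> (invertible⇒# {1#} {0#} (1# , 1*[1-0]≈1 , trans (*-comm _ _) 1*[1-0]≈1))
    where
    1*[1-0]≈1 : 1# * (1# - 0#) ≈ 1#
    1*[1-0]≈1 = trans (*-identityˡ _) (trans (+-congˡ -0#≈0#) (+-identityʳ 1#))
  ... | inj₂ 0<1 = 0<1
  ... | inj₁ 1<0 = <.<-respʳ-≈ (trans (-1*x≈-x (- 1#)) (-‿involutive 1#)) (*-pos 0<-1 0<-1)
    where
    0<-1 : 0# < - 1#
    0<-1 = <.<-respˡ-≈ (-‿inverseʳ 1#) (<.<-respʳ-≈ (+-identityˡ _) (+-monoˡ-< (- 1#) 1<0))

  0<card : ∀ n → 0# < card (suc n)
  0<card zero    = <.<-respʳ-≈ (sym (+-identityʳ 1#)) 0<1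
  0<card (suc n) = <.trans (0<card n) (<.<-respˡ-≈ (+-identityˡ _) (+-monoˡ-< (card (suc n)) 0<1))

  -- Positive elements are apart from 0 and hence invertible; this supplies the reciprocals needed
  -- for means.
  card-invertible : ∀ n → Σ[ h ∈ Carrier ] h * card (suc n) ≈ 1#
  card-invertible n with #⇒invertible (#-sym (<⇒# (0<card n)))
  ... | h , h*[card-0]≈1 , _ = h , trans (*-congˡ (sym (trans (+-congˡ -0#≈0#) (+-identityʳ _)))) h*[card-0]≈1

  module _ {n} {M L : Matrix n n} (isL : IsNormalizedLaplacian M L) where

    open IsNormalizedLaplacian isL

    -- Replaces permutation and decomposition by the single formula `I - D M D`, valid on zero rows
    -- too, so that the block structure can be used in its original order.
    laplacian-scaling : Σ[ d ∈ Vector Carrier n ] Σ[ d⁻¹ ∈ Vector Carrier n ]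
      (∀ s → d s * d⁻¹ s ≈ 1#) × (∀ s → Normalises (M s) (d s * d s)) × L ≈ₘ (λ s t → Iₘ n s t - d s * M s t * d t)
    laplacian-scaling with L₁-isL[M₁]
    ... | _ , d , isInverseSqrt , L₁≈ =
      -- As the row sum times `d i * d i` is 1, the inverse of `d i` is the row sum times `d i`.
      extend d ∘ (σ ⟨$⟩ˡ_) , extend (λ i → sum (M₁ i) * d i) ∘ (σ ⟨$⟩ˡ_) ,
      (λ s → extend-inverse inverse (σ ⟨$⟩ˡ s)) , normalises , L≈
      where
      inverse : ∀ i → d i * (sum (M₁ i) * d i) ≈ 1#
      inverse i = begin
        d i * (sum (M₁ i) * d i)   ≈⟨ *-comm _ _ ⟩
        sum (M₁ i) * d i * d i     ≈⟨ *-assoc _ _ _ ⟩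
        sum (M₁ i) * (d i * d i)   ≈⟨ proj₂ (isInverseSqrt i) ⟩
        1#                         ∎

      unpermute : ∀ (X : Matrix n n) s t → X s t ≡ permute σ X (σ ⟨$⟩ˡ s) (σ ⟨$⟩ˡ t)
      unpermute X s t = ≡.sym (≡.cong₂ X (Perm.inverseʳ σ) (Perm.inverseʳ σ))

      M≈ : ∀ s t → M s t ≈ (M₁ ⊕ 0ₘ k) (σ ⟨$⟩ˡ s) (σ ⟨$⟩ˡ t)
      M≈ s t = trans (reflexive (unpermute M s t)) (M-decomp _ _)

      normalises : ∀ s → Normalises (M s) (extend d (σ ⟨$⟩ˡ s) * extend d (σ ⟨$⟩ˡ s))
      normalises s with extend-normalises {k = k} {M₁} {L₁} {d} (λ i → proj₂ (isInverseSqrt i)) (σ ⟨$⟩ˡ s)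
      ... | inj₁ row≈0   = inj₁ λ t → trans (M≈ s t) (row≈0 _)
      ... | inj₂ sum*d²≈1 = inj₂ (trans (*-congʳ (trans (sum-cong-≋ (M≈ s)) (sym (sum-permute ((M₁ ⊕ 0ₘ k) (σ ⟨$⟩ˡ s)) (Perm.flip σ))))) sum*d²≈1)

      σˡ-injective : ∀ {s t} → σ ⟨$⟩ˡ s ≡ σ ⟨$⟩ˡ t → s ≡ t
      σˡ-injective eq = ≡.trans (≡.sym (Perm.inverseʳ σ)) (≡.trans (≡.cong (σ ⟨$⟩ʳ_) eq) (Perm.inverseʳ σ))

      L≈ : L ≈ₘ λ s t → Iₘ n s t - extend d (σ ⟨$⟩ˡ s) * M s t * extend d (σ ⟨$⟩ˡ t)
      L≈ s t = begin
        L s t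
          ≡⟨ unpermute L s t ⟩
        permute σ L (σ ⟨$⟩ˡ s) (σ ⟨$⟩ˡ t)
          ≈⟨ L-decomp _ _ ⟩
        (L₁ ⊕ Iₘ k) (σ ⟨$⟩ˡ s) (σ ⟨$⟩ˡ t)
          ≈⟨ extend-laplacian L₁≈ (σ ⟨$⟩ˡ s) (σ ⟨$⟩ˡ t) ⟩
        Iₘ (r ℕ.+ k) (σ ⟨$⟩ˡ s) (σ ⟨$⟩ˡ t) - extend d (σ ⟨$⟩ˡ s) * (M₁ ⊕ 0ₘ k) (σ ⟨$⟩ˡ s) (σ ⟨$⟩ˡ t) * extend d (σ ⟨$⟩ˡ t)
          ≈⟨ +-cong (I-injective (σ ⟨$⟩ˡ_) σˡ-injective s t) (-‿cong (*-congʳ (*-congˡ (sym (M≈ s t))))) ⟩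
        Iₘ n s t - extend d (σ ⟨$⟩ˡ s) * M s t * extend d (σ ⟨$⟩ˡ t) ∎

  module _ {p q} (n k z : ℕ) (B : Matrix p q) where

    open BlockGraph p q k (n / suc k ℕ.∸ 1) z

    -- `decode` and `position` perform the same nested splits, so following the splits makes both
    -- sides compute.
    label-position : ∀ s → label (decode s) ≡ [ just ∘ position n (suc k) , (λ _ → nothing) ]′ (splitAt size s)
    label-position s with splitAt size s
    ... | inj₂ _ = ≡.refl
    ... | inj₁ s′ with splitAt p s′
    ...   | inj₁ _ = ≡.refl
    ...   | inj₂ s″ with splitAt (suc k ℕ.* q) s″
    ...     | inj₁ _ = ≡.refl
    ...     | inj₂ _ = ≡.refl

    F-entry : ∀ s t → F n (suc k) B s t ≡ entry B (just (position n (suc k) s)) (just (position n (suc k) t))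
    F-entry s t with position {p} {q} n (suc k) s | position {p} {q} n (suc k) t
    ... | inj₁ _ | inj₁ _ = ≡.refl
    ... | inj₁ _ | inj₂ _ = ≡.refl
    ... | inj₂ _ | inj₁ _ = ≡.refl
    ... | inj₂ _ | inj₂ _ = ≡.refl

    entry-nothingʳ : ∀ x → entry B x nothing ≡ 0#
    entry-nothingʳ (just (inj₁ _)) = ≡.refl
    entry-nothingʳ (just (inj₂ _)) = ≡.refl
    entry-nothingʳ nothing         = ≡.refl

    F⊕0-adjacency : ∀ s t → (F n (suc k) B ⊕ 0ₘ z) s t ≡ adjacency B (decode s) (decode t)
    F⊕0-adjacency s t rewrite label-position s | label-position t with splitAt size s | splitAt size t
    ... | inj₁ s′ | inj₁ t′ = F-entry s′ t′
    ... | inj₁ s′ | inj₂ _  = ≡.sym (entry-nothingʳ (just (position n (suc k) s′)))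
    ... | inj₂ _  | inj₁ _  = ≡.refl
    ... | inj₂ _  | inj₂ _  = ≡.refl

theorem3p6 : ∀ {c ℓ₁ ℓ₂} (ℝ : RealField c ℓ₁ ℓ₂) → let open RealMatrices ℝ in
    (n p q : ℕ) .{{_ : NonZero n}} .{{_ : NonZero p}} .{{_ : NonZero q}} →
    q ℕ.≤ p →
    (B : Matrix p q) → Nonnegative B →
    (k l : ℕ) .{{_ : NonZero k}} .{{_ : NonZero l}} → k ∣ n → l ∣ n →
    ∀ Lₖ Lₗ →
    IsNormalizedLaplacian (F n k B ⊕ 0ₘ (padding p q n k)) Lₖ →
    IsNormalizedLaplacian (F n l B ⊕ 0ₘ (padding p q n l)) Lₗ →
    Cospectral Lₖ Lₗ
theorem3p6 ℝ n p q q≤p B _ (suc k) (suc l) k∣n l∣n Lₖ Lₗ isLₖ isLₗ =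
  similar⇒cospectral sizes (reductions⇒similar rests (reduction k isLₖ) (reduction l isLₗ))
  where
  open RealField ℝ using (reflexive; commutativeRing)
  open RealMatrices ℝ
  open RealSpectra ℝ
  open Blocks commutativeRing

  copies : ℕ → ℕ
  copies k = n / suc k ℕ.∸ 1

  rest : ℕ → ℕ
  rest k = copies k ℕ.* p ℕ.+ k ℕ.* q ℕ.+ padding p q n (suc k)

  sizes : sizeF p q n (suc k) ℕ.+ padding p q n (suc k) ≡ sizeF p q n (suc l) ℕ.+ padding p q n (suc l)
  sizes = ≡.trans (totalSize p q n (suc k) q≤p k∣n) (≡.sym (totalSize p q n (suc l) q≤p l∣n))

  -- Setting aside one copy of each row and column of `B` accounts for `p + q`; what remains counts
  -- the deviations and the padding.
  size-rest : ∀ p q k m z → p ℕ.+ (suc k ℕ.* q ℕ.+ m ℕ.* p) ℕ.+ z ≡ (p ℕ.+ q) ℕ.+ (m ℕ.* p ℕ.+ k ℕ.* q ℕ.+ z)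
  size-rest = ℕ-Solver.solve-∀

  rests : rest k ≡ rest l
  rests = ℕ.+-cancelˡ-≡ (p ℕ.+ q) _ _
    (≡.trans (≡.sym (size-rest p q k (copies k) (padding p q n (suc k))))
      (≡.trans sizes (size-rest p q l (copies l) (padding p q n (suc l)))))

  reduction : ∀ k {L} → IsNormalizedLaplacian (F n (suc k) B ⊕ 0ₘ (padding p q n (suc k))) L → Reduction B L (rest k)
  -- The divisor is `suc k`, and since it divides the positive `n`, `suc (copies k)` is the true
  -- quotient. The reciprocals obtained are those of the numbers of size-`q` and size-`p` blocks.
  reduction k {L} isL with laplacian-scaling isL | card-invertible k | card-invertible (copies k)
  ... | d , d⁻¹ , dd⁻¹≈1 , norm , L≈ | h , h*k≈1 | h′ , h′*m≈1 =
    BlockGraph.laplacian-reduction p q k (copies k) _ B _ L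
      (λ s t → reflexive (F⊕0-adjacency n k _ B s t)) d d⁻¹ dd⁻¹≈1 norm L≈ h h′ h*k≈1 h′*m≈1
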